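{- For any $x\in\mathbb{Q}$, \[ \gamma_{\mathcal{A}}^{\mathrm{M}}(x)=\gamma_{\mathcal{A}}^{\mathrm{W}}+\ell_{\mathcal{A}}(x+2)-\ell_{\mathcal{A}}(x+1)+\delta_{ -1}(x)-1\quad\text{in }\mathcal{A}. \] In particular, $\gamma_{\mathcal{A}}^{\mathrm{M}}(-1)=\gamma_{\mathcal{A}}^{\mathrm{W}}$.
   Context: $\mathcal{A}\coloneqq\big(\prod_{p\text{ prime}}\mathbb{Z}/p\mathbb{Z}\big)/\big(\bigoplus_{p\text{ prime}}\mathbb{Z}/p\mathbb{Z}\big)$, a $\mathbb{Q}$-algebra via the diagonal embedding of $\mathbb{Q}$ (for the finitely many primes dividing a denominator, the $p$-component is assigned arbitrarily). Gregory polynomials $G_n(x)\in\mathbb{Q}[x]$ are defined by $\frac{t(1+t)^x}{\log(1+t)}=\sum_{n\ge0}G_n(x)t^n$. Define $\gamma_{\mathcal{A}}^{\mathrm{M}}(x)\coloneqq\big(\sum_{n=1}^{p-2}\frac{(-1)^{n-1}G_n(x)}{n}\bmod p\big)_p$, $\gamma_{\mathcal{A}}^{\mathrm{W}}\coloneqq\big(\frac{(p-1)!+1}{p}\bmod p\big)_p$, and for $x\in\mathbb{Q}$, $\ell_{\mathcal{A}}(x)\coloneqq\big(\frac{x^p-x}{p}\bmod p\big)_p$ (i.e. $x$ times the Fermat quotient $q_p(x)=\frac{x^{p-1}-1}{p}$; in particular $\ell_{\mathcal{A}}(0)=0$). $\delta_{ -1}$ is the indicator function of $\{ -1\}$. 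-}

module Defs where

open import Data.Nat as ℕ using (ℕ; zero; suc; _∸_; _<_; _!)
open import Data.Nat.Divisibility using (_∣_)
open import Data.Nat.Primality using (Prime)
open import Data.Integer as ℤ using (ℤ; +_; -[1+_])
open import Data.Rational using (ℚ; _+_; _*_; _-_; _/_; ↥_; 0ℚ; 1ℚ; -_)
open import Data.Rational.Properties using (_≟_)
open import Data.List using (List; []; _∷_; map; foldr; zipWith; upTo; length)
open import Data.Product using (∃)
open import Relation.Nullary.Decidable using (yes; no)

ℕ→ℚ : ℕ → ℚ
ℕ→ℚ n = + n / 1

-- 1/n (only used for n ≠ 0; 1/0 is set to 0)
inv : ℕ → ℚ
inv zero    = 0ℚ
inv (suc n) = + 1 / suc n

sumQ : List ℚ → ℚ
sumQ = foldr _+_ 0ℚ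

_^ℚ_ : ℚ → ℕ → ℚ
q ^ℚ zero  = 1ℚ
q ^ℚ suc n = q * (q ^ℚ n)

sgn : ℕ → ℚ
sgn n = (- 1ℚ) ^ℚ n

-- generalized binomial coefficient  binom(x, k) = x(x-1)...(x-k+1)/k!,
-- i.e. the coefficient of t^k in (1+t)^x
binomQ : ℚ → ℕ → ℚ
binomQ x zero    = 1ℚ
binomQ x (suc k) = binomQ x k * (x - ℕ→ℚ k) * inv (suc k)

-- coefficient of t^m in log(1+t)/t = Σ_{m≥0} (-1)^m t^m/(m+1)
logCoef : ℕ → ℚ
logCoef m = sgn m * inv (suc m)

-- Gregory polynomials: t(1+t)^x / log(1+t) = Σ G_n(x) t^n, i.e.
-- (Σ G_n(x) t^n) · (log(1+t)/t) = (1+t)^x as formal power series.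
-- Comparing coefficients of t^n:  Σ_{k=0}^{n} G_k(x) · logCoef(n-k) = binom(x,n),
-- and since logCoef 0 = 1 this determines G_n(x) recursively.
-- gregRev x n = [G_n(x), G_{n-1}(x), ..., G_0(x)].
gregRev : ℚ → ℕ → List ℚ
gregRev x zero    = binomQ x 0 ∷ []
gregRev x (suc n) =
  let r = gregRev x n in
  (binomQ x (suc n) - sumQ (zipWith _*_ r (map (λ j → logCoef (suc j)) (upTo (length r))))) ∷ r

headQ : List ℚ → ℚ
headQ []      = 0ℚ
headQ (q ∷ _) = q

G : ℕ → ℚ → ℚ
G n x = headQ (gregRev x n)

-- Elements of 𝒜 represented by sequences of rationals indexed by primes p:
-- the p-component is the reduction mod p (meaningful for all but finitely many p).
-- Two such families are equal in 𝒜 iff for all sufficiently large primes p,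
-- a_p - b_p ≡ 0 mod p, i.e. p divides the numerator of a_p - b_p (in lowest terms).
_≡𝒜_ : (ℕ → ℚ) → (ℕ → ℚ) → Set
a ≡𝒜 b = ∃ λ N → ∀ p → Prime p → N < p → p ∣ ℤ.∣ ↥ (a p - b p) ∣

γM : ℚ → ℕ → ℚ
γM x p = sumQ (map (λ i → sgn i * G (suc i) x * inv (suc i)) (upTo (p ∸ 2)))

γW : ℕ → ℚ
γW p = ℕ→ℚ (((p ∸ 1) !) ℕ.+ 1) * inv p

ℓ : ℚ → ℕ → ℚ
ℓ x p = ((x ^ℚ p) - x) * inv p

δ₋₁ : ℚ → ℚ
δ₋₁ x with x ≟ (- 1ℚ)
... | yes _ = 1ℚ
... | no  _ = 0ℚ

{-# OPTIONS --safe #-}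

-- Let σ n k be the coefficient of yᵏ in binom(y, n).  Since log(1+t)(1+t)^y = d/dy (1+t)^y, the number
-- Gₙ(x) is the integral of binom(y, n) over [x, x + 1], that is Σₖ σ n k ((x+1)^(k+1) - x^(k+1))/(k+1).
-- Comparing the coefficients of t^(p-1) in (Σ Gₙ(x) tⁿ) · log(1+t)/t = (1+t)^x gives
-- γM(x) ≡ binom(x, p-1) - 1/p - G_{p-1}(x) mod p.  Here binom(x, p-1) ≡ δ₋₁(x), and the derivative identity
-- also yields σ (p-1) k ≡ (-1)^(k-1) mod p for 0 < k < p, hence Wilson's and Fermat's theorems.  In G_{p-1}(x)
-- the term k = p-1 is 1/(p-1)! · ((x+1)^p - x^p)/p and produces γW; the others form a difference of truncated
-- logarithms Φ(X) = Σ_{0<j<p} (-1)^(j-1) X^j/j ≡ ((X+1)^p - X^p - 1)/p and produce the ℓ-terms.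

module Submission where

open import Defs
open import Data.Integer as ℤ using (ℤ; -[1+_]) renaming (+_ to pos)
import Data.Integer.Properties as ℤₚ
open import Data.List using (map; zipWith; upTo; applyUpTo; length)
open import Data.List.Properties using (map-applyUpTo)
open import Data.Nat as ℕ using (ℕ; zero; suc; _∸_; _<_; _≤_; z≤n; s≤s; _!)
open import Data.Nat.Divisibility as ℕᵈ using (_∣_)
open import Data.Nat.Primality using (Prime; euclidsLemma; prime⇒nonTrivial; prime⇒irreducible)
import Data.Nat.Properties as ℕₚ
open import Data.Product using (_×_; _,_)
open import Data.Rational using (ℚ; mkℚ; _+_; _*_; _-_; _/_; ↥_; ↧_; ↧ₙ_; 0ℚ; 1ℚ; -_; toℚᵘ)
open import Data.Rational.Properties
open import Data.Rational.Solver using (module +-*-Solver)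
import Data.Rational.Unnormalised as ℚᵘ
import Data.Rational.Unnormalised.Properties as ℚᵘₚ
open import Data.Sum using (_⊎_; inj₁; inj₂)
open import Function using (_∘_; id)
open import Level using (0ℓ)
open import Relation.Binary.Bundles using (Setoid)
open import Relation.Binary.PropositionalEquality
import Relation.Binary.Reasoning.Setoid as SetoidReasoning
open import Relation.Nullary using (¬_; contradiction; yes; no)

open +-*-Solver

-- The obstacle is that 1/p, G_{p-1}(x) and its top term all have a pole at p, so the computation
-- cannot take place in Z/p. Congruence is therefore defined between arbitrary rationals, as a
-- difference lying in p times the p-integral ones, and the poles cancel only in the closing
-- identity of `γM-formula`. The pole also decides how precisely the coefficients of binom(y, p-1)
-- must be known. Those with k < p-1 multiply p-integral weights, so their residues suffice. The
-- leading one multiplies a weight with denominator p and matters modulo p^2: it is kept as the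
-- exact value 1/(p-1)!, and its deviation from -1 is what brings in the Wilson quotient. The series
-- (1+t)^y in two variables is handled through its coefficients alone. The recursion defining `σ` is
-- the differential equation (1+t) dF/dt = y F, and differentiation and integration in y become
-- multiplication and division of coefficients by k + 1.

-- Integers and natural numbers inside the rationals

ι : ℤ → ℚ
ι i = i / 1

toℚᵘ-ι : ∀ i → toℚᵘ (ι i) ℚᵘ.≃ ℚᵘ.mkℚᵘ i 0
toℚᵘ-ι i = toℚᵘ-fromℚᵘ (ℚᵘ.mkℚᵘ i 0)

ι-+ : ∀ i j → ι (i ℤ.+ j) ≡ ι i + ι j
ι-+ i j = toℚᵘ-injective (ℚᵘₚ.≃-trans (toℚᵘ-ι (i ℤ.+ j)) (ℚᵘₚ.≃-trans
  (ℚᵘ.*≡* (cong (ℤ._* pos 1) (sym (cong₂ ℤ._+_ (ℤₚ.*-identityʳ i) (ℤₚ.*-identityʳ j)))))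
  (ℚᵘₚ.≃-sym (ℚᵘₚ.≃-trans (toℚᵘ-homo-+ (ι i) (ι j)) (ℚᵘₚ.+-cong (toℚᵘ-ι i) (toℚᵘ-ι j))))))

ι-* : ∀ i j → ι (i ℤ.* j) ≡ ι i * ι j
ι-* i j = toℚᵘ-injective (ℚᵘₚ.≃-trans (toℚᵘ-ι (i ℤ.* j)) (ℚᵘₚ.≃-sym
  (ℚᵘₚ.≃-trans (toℚᵘ-homo-* (ι i) (ι j)) (ℚᵘₚ.*-cong (toℚᵘ-ι i) (toℚᵘ-ι j)))))

ι-injective : ∀ {i j} → ι i ≡ ι j → i ≡ j
ι-injective {i} {j} eq with ℚᵘₚ.≃-trans (ℚᵘₚ.≃-sym (toℚᵘ-ι i)) (ℚᵘₚ.≃-trans (ℚᵘₚ.≃-reflexive (cong toℚᵘ eq)) (toℚᵘ-ι j))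
... | ℚᵘ.*≡* e = ℤₚ.*-cancelʳ-≡ i j (pos 1) e

*-↧ : ∀ q → q * ℕ→ℚ (↧ₙ q) ≡ ι (↥ q)
*-↧ q = toℚᵘ-injective (ℚᵘₚ.≃-trans (toℚᵘ-homo-* q (ι (↧ q))) (ℚᵘₚ.≃-trans
  (ℚᵘₚ.*-cong (ℚᵘₚ.≃-refl {toℚᵘ q}) (toℚᵘ-ι (↧ q))) (ℚᵘₚ.≃-trans (lem q) (ℚᵘₚ.≃-sym (toℚᵘ-ι (↥ q))))))
  where
  lem : ∀ q → toℚᵘ q ℚᵘ.* ℚᵘ.mkℚᵘ (↧ q) 0 ℚᵘ.≃ ℚᵘ.mkℚᵘ (↥ q) 0
  lem (mkℚ n d _) = ℚᵘ.*≡* (trans (ℤₚ.*-identityʳ _)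
    (cong (λ z → n ℤ.* pos z) (sym (ℕₚ.*-identityʳ (suc d)))))

ν-+ : ∀ m n → ℕ→ℚ (m ℕ.+ n) ≡ ℕ→ℚ m + ℕ→ℚ n
ν-+ m n = ι-+ (pos m) (pos n)

ν-* : ∀ m n → ℕ→ℚ (m ℕ.* n) ≡ ℕ→ℚ m * ℕ→ℚ n
ν-* m n = trans (cong ι (ℤₚ.pos-* m n)) (ι-* (pos m) (pos n))

ν-suc : ∀ n → ℕ→ℚ (suc n) ≡ 1ℚ + ℕ→ℚ n
ν-suc = ν-+ 1

ν*inv : ∀ n → ℕ→ℚ (suc n) * inv (suc n) ≡ 1ℚ
ν*inv n = toℚᵘ-injective (ℚᵘₚ.≃-trans (toℚᵘ-homo-* (ℕ→ℚ (suc n)) (inv (suc n))) (ℚᵘₚ.≃-trans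
  (ℚᵘₚ.*-cong (toℚᵘ-ι (pos (suc n))) (toℚᵘ-fromℚᵘ (ℚᵘ.mkℚᵘ (pos 1) n))) (ℚᵘ.*≡* (lem (pos (suc n))))))
  where
  lem : ∀ i → (i ℤ.* pos 1) ℤ.* pos 1 ≡ (pos 1) ℤ.* (pos 1 ℤ.* i)
  lem i = trans (ℤₚ.*-identityʳ _) (trans (ℤₚ.*-identityʳ i) (sym (trans (ℤₚ.*-identityˡ _) (ℤₚ.*-identityˡ i))))

inv-cancelˡ : ∀ n q → inv (suc n) * (ℕ→ℚ (suc n) * q) ≡ q
inv-cancelˡ n q = trans (solve 3 (λ i v q → i :* (v :* q) := (v :* i) :* q) refl (inv (suc n)) (ℕ→ℚ (suc n)) q)
  (trans (cong (_* q) (ν*inv n)) (*-identityˡ q))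

ν*-cancelˡ : ∀ n {q r} → ℕ→ℚ (suc n) * q ≡ ℕ→ℚ (suc n) * r → q ≡ r
ν*-cancelˡ n {q} {r} e = trans (sym (inv-cancelˡ n q)) (trans (cong (inv (suc n) *_) e) (inv-cancelˡ n r))

-- Sums and convolutions

infix 8 Σ[_]_

opaque
  -- Opaque, because later bounds such as p = 3 + r begin with successors and a transparent sum
  -- would unfold its leading terms in every goal.
  Σ[_]_ : ℕ → (ℕ → ℚ) → ℚ
  Σ[ zero  ] f = 0ℚ
  Σ[ suc n ] f = f 0 + Σ[ n ] (f ∘ suc)

  Σ-base : ∀ f → Σ[ 0 ] f ≡ 0ℚ
  Σ-base f = refl

  Σ-suc : ∀ n f → Σ[ suc n ] f ≡ f 0 + Σ[ n ] (f ∘ suc)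
  Σ-suc n f = refl

  Σ-cong : ∀ n {f g} → (∀ i → i < n → f i ≡ g i) → Σ[ n ] f ≡ Σ[ n ] g
  Σ-cong zero e = refl
  Σ-cong (suc n) e = cong₂ _+_ (e 0 (s≤s z≤n)) (Σ-cong n (λ i i<n → e (suc i) (s≤s i<n)))

  Σ-+ : ∀ n f g → Σ[ n ] (λ i → f i + g i) ≡ Σ[ n ] f + Σ[ n ] g
  Σ-+ zero f g = refl
  Σ-+ (suc n) f g = trans (cong (f 0 + g 0 +_) (Σ-+ n (f ∘ suc) (g ∘ suc)))
    (solve 4 (λ a b c d → (a :+ b) :+ (c :+ d) := (a :+ c) :+ (b :+ d))
          refl (f 0) (g 0) (Σ[ n ] (f ∘ suc)) (Σ[ n ] (g ∘ suc)))

  Σ-*ˡ : ∀ n a f → Σ[ n ] (λ i → a * f i) ≡ a * Σ[ n ] f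
  Σ-*ˡ zero a f = sym (*-zeroʳ a)
  Σ-*ˡ (suc n) a f = trans (cong (a * f 0 +_) (Σ-*ˡ n a (f ∘ suc))) (sym (*-distribˡ-+ a (f 0) _))

  Σ-minus : ∀ n f g → Σ[ n ] (λ i → f i - g i) ≡ Σ[ n ] f - Σ[ n ] g
  Σ-minus zero f g = refl
  Σ-minus (suc n) f g = trans (cong (f 0 - g 0 +_) (Σ-minus n (f ∘ suc) (g ∘ suc)))
    (solve 4 (λ a b c d → (a :- b) :+ (c :- d) := (a :+ c) :- (b :+ d))
          refl (f 0) (g 0) (Σ[ n ] (f ∘ suc)) (Σ[ n ] (g ∘ suc)))

  Σ-last : ∀ n f → Σ[ suc n ] f ≡ Σ[ n ] f + f n
  Σ-last zero f = +-comm (f 0) 0ℚ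
  Σ-last (suc n) f = trans (cong (f 0 +_) (Σ-last n (f ∘ suc))) (sym (+-assoc (f 0) _ _))

  Σ-zero : ∀ n {f} → (∀ i → i < n → f i ≡ 0ℚ) → Σ[ n ] f ≡ 0ℚ
  Σ-zero zero e = refl
  Σ-zero (suc n) e = cong₂ _+_ (e 0 (s≤s z≤n)) (Σ-zero n (λ i i<n → e (suc i) (s≤s i<n)))

  sumQ-upTo : ∀ n f → sumQ (map f (upTo n)) ≡ Σ[ n ] f
  sumQ-upTo n f = trans (cong sumQ (map-applyUpTo id f n)) (lem n f)
    where
    lem : ∀ n f → sumQ (applyUpTo f n) ≡ Σ[ n ] f
    lem zero f = refl
    lem (suc n) f = cong (f 0 +_) (lem n (f ∘ suc))

-- The Euler operator t d/dt on the coefficients of a power series.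
θ : (ℕ → ℚ) → ℕ → ℚ
θ f i = ℕ→ℚ i * f i

opaque
  conv : (ℕ → ℚ) → (ℕ → ℚ) → ℕ → ℚ
  conv f g n = Σ[ suc n ] (λ i → f i * g (n ∸ i))

  conv-def : ∀ f g n → conv f g n ≡ Σ[ suc n ] (λ i → f i * g (n ∸ i))
  conv-def f g n = refl

  conv-cong : ∀ {f f′ g g′} n → (∀ i → i ≤ n → f i ≡ f′ i) → (∀ i → g i ≡ g′ i) → conv f g n ≡ conv f′ g′ n
  conv-cong n e e′ = Σ-cong (suc n) (λ i i<n → cong₂ _*_ (e i (ℕₚ.≤-pred i<n)) (e′ (n ∸ i)))

  conv-last : ∀ f g n → conv f g (suc n) ≡ conv f (g ∘ suc) n + f (suc n) * g 0
  conv-last f g n = trans (Σ-last (suc n) (λ i → f i * g (suc n ∸ i)))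
    (cong₂ _+_ (Σ-cong (suc n) (λ i i<n → cong (λ j → f i * g j) (ℕₚ.+-∸-assoc 1 (ℕₚ.≤-pred i<n))))
               (cong (λ j → f (suc n) * g j) (ℕₚ.n∸n≡0 n)))

  conv-+ʳ : ∀ f g g′ n → conv f (λ i → g i + g′ i) n ≡ conv f g n + conv f g′ n
  conv-+ʳ f g g′ n = trans (Σ-cong (suc n) (λ i _ → *-distribˡ-+ (f i) (g (n ∸ i)) (g′ (n ∸ i)))) (Σ-+ (suc n) _ _)

  conv-0ˡ : ∀ {f} g n → (∀ i → f i ≡ 0ℚ) → conv f g n ≡ 0ℚ
  conv-0ˡ g n e = Σ-zero (suc n) (λ i _ → trans (cong (_* g (n ∸ i)) (e i)) (*-zeroˡ (g (n ∸ i))))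

  -- Product rule for t d/dt: in each term of the convolution, n splits as i + (n - i).
  conv-Leibniz : ∀ f g n → ℕ→ℚ n * conv f g n ≡ conv (θ f) g n + conv f (θ g) n
  conv-Leibniz f g n = begin
    ℕ→ℚ n * conv f g n ≡⟨ Σ-*ˡ (suc n) (ℕ→ℚ n) _ ⟨
    Σ[ suc n ] (λ i → ℕ→ℚ n * (f i * g (n ∸ i))) ≡⟨ Σ-cong (suc n) split ⟩
    Σ[ suc n ] (λ i → θ f i * g (n ∸ i) + f i * θ g (n ∸ i)) ≡⟨ Σ-+ (suc n) _ _ ⟩
    conv (θ f) g n + conv f (θ g) n ∎
    where
    open ≡-Reasoning
    split : ∀ i → i < suc n → ℕ→ℚ n * (f i * g (n ∸ i)) ≡ θ f i * g (n ∸ i) + f i * θ g (n ∸ i)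
    split i (s≤s i≤n) = trans
      (cong (_* (f i * g (n ∸ i))) (trans (cong ℕ→ℚ (sym (ℕₚ.m+[n∸m]≡n i≤n))) (ν-+ i (n ∸ i))))
      (solve 4 (λ a b c d → (a :+ b) :* (c :* d) := (a :* c) :* d :+ c :* (b :* d)) refl
        (ℕ→ℚ i) (ℕ→ℚ (n ∸ i)) (f i) (g (n ∸ i)))

  -- With f = `σ` and integrals of powers of y as weights, this moves the convolution in t under the
  -- integral over y.
  Σ-conv : ∀ N n (f : ℕ → ℕ → ℚ) (w g : ℕ → ℚ) →
    conv (λ m → Σ[ N ] (λ k → f m k * w k)) g n ≡ Σ[ N ] (λ k → conv (λ m → f m k) g n * w k)
  Σ-conv zero n f w g = trans (conv-0ˡ g n (λ _ → Σ-base _)) (sym (Σ-base _))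
  Σ-conv (suc N) n f w g = begin
    conv (λ m → Σ[ suc N ] (λ k → f m k * w k)) g n
      ≡⟨ conv-cong {g = g} n (λ m _ → Σ-suc N _) (λ _ → refl) ⟩
    conv (λ m → f m 0 * w 0 + T m) g n
      ≡⟨ Σ-cong (suc n) (λ i _ → solve 4 (λ a w t g → (a :* w :+ t) :* g := w :* (a :* g) :+ t :* g) refl
            (f i 0) (w 0) (T i) (g (n ∸ i))) ⟩
    Σ[ suc n ] (λ i → w 0 * (f i 0 * g (n ∸ i)) + T i * g (n ∸ i)) ≡⟨ Σ-+ (suc n) _ _ ⟩
    Σ[ suc n ] (λ i → w 0 * (f i 0 * g (n ∸ i))) + conv T g n
      ≡⟨ cong₂ _+_ (trans (Σ-*ˡ (suc n) (w 0) _) (*-comm (w 0) _)) (Σ-conv N n (λ m → f m ∘ suc) (w ∘ suc) g) ⟩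
    conv (λ m → f m 0) g n * w 0 + Σ[ N ] (λ k → conv (λ m → f m (suc k)) g n * w (suc k))
      ≡⟨ Σ-suc N _ ⟨
    Σ[ suc N ] (λ k → conv (λ m → f m k) g n * w k) ∎
    where
    open ≡-Reasoning
    T : ℕ → ℚ
    T m = Σ[ N ] (λ k → f m (suc k) * w (suc k))

  conv-zero : ∀ f g → conv f g 0 ≡ f 0 * g 0
  conv-zero f g = trans (Σ-suc 0 _) (trans (cong (f 0 * g 0 +_) (Σ-base _)) (+-identityʳ (f 0 * g 0)))

  conv-head : ∀ f g n → conv f g (suc n) ≡ f 0 * g (suc n) + conv (f ∘ suc) g n
  conv-head f g n = Σ-suc (suc n) _

  conv-+ˡ : ∀ f f′ g n → conv (λ i → f i + f′ i) g n ≡ conv f g n + conv f′ g n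
  conv-+ˡ f f′ g n = trans (Σ-cong (suc n) (λ i _ → *-distribʳ-+ (g (n ∸ i)) (f i) (f′ i))) (Σ-+ (suc n) _ _)

  conv-negʳ : ∀ f g n → conv f (λ i → - 1ℚ * g i) n ≡ - conv f g n
  conv-negʳ f g n = trans (Σ-cong (suc n) (λ i _ →
      solve 2 (λ a b → a :* (:- con 1ℚ :* b) := :- con 1ℚ :* (a :* b)) refl (f i) (g (n ∸ i))))
    (trans (Σ-*ˡ (suc n) (- 1ℚ) _) (solve 1 (λ a → :- con 1ℚ :* a := :- a) refl (conv f g n)))

-- Gregory polynomials as integrals

-- coefficient of y^k in binom(y, n)
σ : ℕ → ℕ → ℚ
σ zero    zero    = 1ℚ
σ zero    (suc k) = 0ℚ
σ (suc n) zero    = - (ℕ→ℚ n * σ n zero) * inv (suc n)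
σ (suc n) (suc k) = (σ n k - ℕ→ℚ n * σ n (suc k)) * inv (suc n)

ν*-inv-cancel : ∀ n q → ℕ→ℚ (suc n) * (q * inv (suc n)) ≡ q
ν*-inv-cancel n q = trans (solve 3 (λ i v q → v :* (q :* i) := i :* (v :* q)) refl (inv (suc n)) (ℕ→ℚ (suc n)) q)
  (inv-cancelˡ n q)

σ-suc-zero : ∀ n → σ (suc n) 0 ≡ 0ℚ
σ-suc-zero zero = refl
σ-suc-zero (suc n) = trans (cong (λ z → - (ℕ→ℚ (suc n) * z) * inv (suc (suc n))) (σ-suc-zero n))
  (solve 2 (λ a b → :- (a :* con 0ℚ) :* b := con 0ℚ) refl (ℕ→ℚ (suc n)) (inv (suc (suc n))))

σ-rec : ∀ n k → ℕ→ℚ (suc n) * σ (suc n) (suc k) ≡ σ n k - ℕ→ℚ n * σ n (suc k)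
σ-rec n k = ν*-inv-cancel n _

σ-zero : ∀ {n k} → n < k → σ n k ≡ 0ℚ
σ-zero {zero} (s≤s z≤n) = refl
σ-zero {suc n} {suc k} (s≤s n<k) = trans
  (cong₂ (λ a b → (a - ℕ→ℚ n * b) * inv (suc n)) (σ-zero n<k) (σ-zero (ℕₚ.m≤n⇒m≤1+n n<k)))
  (solve 2 (λ a b → (con 0ℚ :- a :* con 0ℚ) :* b := con 0ℚ) refl (ℕ→ℚ n) (inv (suc n)))

-- The bound `N` is left free above the degree because the induction step meets the same polynomial
-- summed up to `N` and up to `suc N`: multiplication by y shifts the index.
eval-σ : ∀ y N n → n < N → Σ[ N ] (λ k → σ n k * (y ^ℚ k)) ≡ binomQ y n
eval-σ y (suc N) zero _ = trans (Σ-suc N _) (trans (cong (1ℚ * 1ℚ +_) (Σ-zero N (λ i _ → *-zeroˡ (y ^ℚ suc i)))) refl)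
eval-σ y (suc N) (suc n) (s≤s n<N) = begin
  Σ[ suc N ] (λ k → σ (suc n) k * (y ^ℚ k)) ≡⟨ Σ-suc N _ ⟩
  σ (suc n) 0 * 1ℚ + Σ[ N ] (λ k → σ (suc n) (suc k) * (y ^ℚ suc k))
    ≡⟨ cong₂ _+_ (head n) (Σ-cong N (λ k _ → solve 6 (λ a b n i y p → (a :- n :* b) :* i :* (y :* p) :=
         y :* i :* (a :* p) :- n :* i :* (b :* (y :* p))) refl (σ n k) (σ n (suc k)) ν i y (y ^ℚ k))) ⟩
  - (ν * i * σ n 0) + Σ[ N ] (λ k → y * i * (σ n k * (y ^ℚ k)) - ν * i * t k)
    ≡⟨ cong (- (ν * i * σ n 0) +_) (trans (Σ-minus N _ _) (cong₂ _-_ (Σ-*ˡ N (y * i) _) (Σ-*ˡ N (ν * i) _))) ⟩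
  - (ν * i * σ n 0) + (y * i * Σ[ N ] (λ k → σ n k * (y ^ℚ k)) - ν * i * Σ[ N ] t)
    ≡⟨ solve 5 (λ νi s yi e t → :- (νi :* s) :+ (yi :* e :- νi :* t) := yi :* e :- νi :* (s :* con 1ℚ :+ t)) refl
         (ν * i) (σ n 0) (y * i) _ _ ⟩
  y * i * Σ[ N ] (λ k → σ n k * (y ^ℚ k)) - ν * i * (σ n 0 * 1ℚ + Σ[ N ] t)
    ≡⟨ cong₂ (λ a b → y * i * a - ν * i * b) (eval-σ y N n n<N)
         (trans (sym (Σ-suc N _)) (eval-σ y (suc N) n (ℕₚ.m≤n⇒m≤1+n n<N))) ⟩
  y * i * binomQ y n - ν * i * binomQ y n
    ≡⟨ solve 4 (λ y i n b → y :* i :* b :- n :* i :* b := b :* (y :- n) :* i) refl y i ν (binomQ y n) ⟩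
  binomQ y (suc n) ∎
  where
  open ≡-Reasoning
  i = inv (suc n)
  ν = ℕ→ℚ n
  t : ℕ → ℚ
  t k = σ n (suc k) * (y ^ℚ suc k)
  head : ∀ n → σ (suc n) 0 * 1ℚ ≡ - (ℕ→ℚ n * inv (suc n) * σ n 0)
  head n = solve 3 (λ v s i → :- (v :* s) :* i :* con 1ℚ := :- (v :* i :* s)) refl (ℕ→ℚ n) (σ n 0) (inv (suc n))

binomQ-rec : ∀ y n → ℕ→ℚ (suc n) * binomQ y (suc n) ≡ binomQ y n * (y - ℕ→ℚ n)
binomQ-rec y n = ν*-inv-cancel n _

binomQ-Pascal : ∀ y n → binomQ (y + 1ℚ) (suc n) ≡ binomQ y (suc n) + binomQ y n
binomQ-Pascal y zero = solve 1 (λ y → con 1ℚ :* (y :+ con 1ℚ :- con 0ℚ) :* con 1ℚ := con 1ℚ :* (y :- con 0ℚ) :* con 1ℚ :+ con 1ℚ)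
      refl y
binomQ-Pascal y (suc n) = ν*-cancelˡ (suc n) (begin
  N * binomQ (y + 1ℚ) (suc (suc n)) ≡⟨ binomQ-rec (y + 1ℚ) (suc n) ⟩
  binomQ (y + 1ℚ) (suc n) * (y + 1ℚ - ℕ→ℚ (suc n))
    ≡⟨ cong₂ (λ a b → a * (y + 1ℚ - b)) (binomQ-Pascal y n) (ν-suc n) ⟩
  (b′ + b) * (y + 1ℚ - (1ℚ + v))
    ≡⟨ solve 4 (λ b′ b y v → (b′ :+ b) :* (y :+ con 1ℚ :- (con 1ℚ :+ v))
           := (b :* (y :- v) :+ b′ :* (y :- (con 1ℚ :+ v))) :+ b′) refl b′ b y v ⟩
  (b * (y - v) + b′ * (y - (1ℚ + v))) + b′
    ≡⟨ cong (_+ b′) (cong₂ _+_ (sym (binomQ-rec y n)) (cong (λ z → b′ * (y - z)) (sym (ν-suc n)))) ⟩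
  (ℕ→ℚ (suc n) * b′ + b′ * (y - ℕ→ℚ (suc n))) + b′
    ≡⟨ cong (λ z → (ℕ→ℚ (suc n) * b′ + z) + b′) (sym (binomQ-rec y (suc n))) ⟩
  (ℕ→ℚ (suc n) * b′ + N * b″) + b′
    ≡⟨ cong (λ z → (ℕ→ℚ (suc n) * b′ + z * b″) + b′) (ν-suc (suc n)) ⟩
  (ℕ→ℚ (suc n) * b′ + (1ℚ + ℕ→ℚ (suc n)) * b″) + b′
    ≡⟨ solve 3 (λ v b′ b″ → (v :* b′ :+ (con 1ℚ :+ v) :* b″) :+ b′ := (con 1ℚ :+ v) :* (b″ :+ b′))
          refl (ℕ→ℚ (suc n)) b′ b″ ⟩
  (1ℚ + ℕ→ℚ (suc n)) * (b″ + b′)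
    ≡⟨ cong (_* (b″ + b′)) (sym (ν-suc (suc n))) ⟩
  N * (b″ + b′) ∎)
  where
  open ≡-Reasoning
  N = ℕ→ℚ (suc (suc n))
  v = ℕ→ℚ n
  b = binomQ y n
  b′ = binomQ y (suc n)
  b″ = binomQ y (suc (suc n))

-- For Λ = log(1+t)/t, the series Λ + tΛ′ is (tΛ)′ = 1/(1+t).
θ-logCoef : ∀ i → logCoef i + θ logCoef i ≡ sgn i
θ-logCoef i = begin
  sgn i * inv (suc i) + ℕ→ℚ i * (sgn i * inv (suc i))
    ≡⟨ solve 3 (λ s j v → s :* j :+ v :* (s :* j) := (con 1ℚ :+ v) :* (s :* j))
          refl (sgn i) (inv (suc i)) (ℕ→ℚ i) ⟩
  (1ℚ + ℕ→ℚ i) * (sgn i * inv (suc i)) ≡⟨ cong (_* (sgn i * inv (suc i))) (ν-suc i) ⟨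
  ℕ→ℚ (suc i) * (sgn i * inv (suc i)) ≡⟨ ν*-inv-cancel i (sgn i) ⟩
  sgn i ∎
  where open ≡-Reasoning

conv-logCoef : ∀ f n → ℕ→ℚ (suc n) * conv f logCoef n ≡ conv (θ f) logCoef n + conv f sgn n
conv-logCoef f n = begin
  ℕ→ℚ (suc n) * a ≡⟨ cong (_* a) (ν-suc n) ⟩
  (1ℚ + ℕ→ℚ n) * a ≡⟨ solve 2 (λ v a → (con 1ℚ :+ v) :* a := v :* a :+ a) refl (ℕ→ℚ n) a ⟩
  ℕ→ℚ n * a + a ≡⟨ cong (_+ a) (conv-Leibniz f logCoef n) ⟩
  (b + conv f (θ logCoef) n) + a ≡⟨ solve 3 (λ b d a → (b :+ d) :+ a := b :+ (a :+ d))
        refl b (conv f (θ logCoef) n) a ⟩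
  b + (a + conv f (θ logCoef) n) ≡⟨ cong (b +_) (sym (conv-+ʳ f logCoef (θ logCoef) n)) ⟩
  b + conv f (λ i → logCoef i + θ logCoef i) n ≡⟨ cong (b +_) (conv-cong {f} n (λ _ _ → refl) θ-logCoef) ⟩
  b + conv f sgn n ∎
  where
  open ≡-Reasoning
  a = conv f logCoef n
  b = conv (θ f) logCoef n

-- The coefficient of t^(n+1) in (1+t) (F log(1+t))′ = (1+t) F′ log(1+t) + F. The factor 1+t clears
-- the 1/(1+t) of `conv-logCoef` and leaves a recursion that can be matched with `σ-rec`.
conv-logCoef-suc : ∀ f n → ℕ→ℚ (suc (suc n)) * conv f logCoef (suc n) ≡
  (conv (θ f ∘ suc) logCoef n + conv (θ f) logCoef n) - ℕ→ℚ (suc n) * conv f logCoef n + f (suc n)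
conv-logCoef-suc f n = begin
  ℕ→ℚ (suc (suc n)) * conv f logCoef (suc n) ≡⟨ conv-logCoef f (suc n) ⟩
  conv (θ f) logCoef (suc n) + conv f sgn (suc n)
    ≡⟨ cong₂ _+_ (conv-head (θ f) logCoef n)
         (trans (conv-last f sgn n) (cong (_+ f (suc n) * 1ℚ) (conv-negʳ f sgn n))) ⟩
  (0ℚ * f 0 * logCoef (suc n) + d) + (- s + f (suc n) * 1ℚ)
    ≡⟨ solve 6 (λ f0 l d s f1 b → (con 0ℚ :* f0 :* l :+ d) :+ (:- s :+ f1 :* con 1ℚ)
          := d :+ b :- (b :+ s) :+ f1) refl
         (f 0) (logCoef (suc n)) d s (f (suc n)) b ⟩
  (d + b) - (b + s) + f (suc n) ≡⟨ cong (λ z → (d + b) - z + f (suc n)) (sym (conv-logCoef f n)) ⟩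
  (d + b) - ℕ→ℚ (suc n) * conv f logCoef n + f (suc n) ∎
  where
  open ≡-Reasoning
  d = conv (θ f ∘ suc) logCoef n
  b = conv (θ f) logCoef n
  s = conv f sgn n

-- d/dy binom(y, n+1) is the coefficient of t^(n+1) in log(1+t) (1+t)^y.
σ-derivative : ∀ n k → ℕ→ℚ (suc k) * σ (suc n) (suc k) ≡ conv (λ m → σ m k) logCoef n
σ-derivative zero zero = sym (conv-zero _ logCoef)
σ-derivative zero (suc k) = trans (*-zeroʳ (ℕ→ℚ (suc (suc k)))) (sym (trans (conv-zero _ logCoef) refl))
σ-derivative (suc n) k = ν*-cancelˡ (suc n) (begin
  N * (ℕ→ℚ (suc k) * σ (suc (suc n)) (suc k))
    ≡⟨ solve 3 (λ a b c → a :* (b :* c) := b :* (a :* c)) refl N (ℕ→ℚ (suc k)) (σ (suc (suc n)) (suc k)) ⟩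
  ℕ→ℚ (suc k) * (N * σ (suc (suc n)) (suc k)) ≡⟨ cong (ℕ→ℚ (suc k) *_) (σ-rec (suc n) k) ⟩
  ℕ→ℚ (suc k) * (s - M * s′)
    ≡⟨ solve 4 (λ k s m s′ → k :* (s :- m :* s′) := k :* s :- m :* (k :* s′)) refl (ℕ→ℚ (suc k)) s M s′ ⟩
  ℕ→ℚ (suc k) * s - M * (ℕ→ℚ (suc k) * s′)
    ≡⟨ cong₂ (λ a b → a * s - M * b) (ν-suc k) (σ-derivative n k) ⟩
  (1ℚ + ℕ→ℚ k) * s - M * e
    ≡⟨ solve 3 (λ k s z → (con 1ℚ :+ k) :* s :- z := k :* s :- z :+ s) refl (ℕ→ℚ k) s (M * e) ⟩
  ℕ→ℚ k * s - M * e + s ≡⟨ cong (λ z → z - M * e + s) (lower k) ⟩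
  (conv (θ f ∘ suc) logCoef n + conv (θ f) logCoef n) - M * e + s ≡⟨ conv-logCoef-suc f n ⟨
  N * conv f logCoef (suc n) ∎)
  where
  open ≡-Reasoning
  N = ℕ→ℚ (suc (suc n))
  M = ℕ→ℚ (suc n)
  s = σ (suc n) k
  s′ = σ (suc n) (suc k)
  f : ℕ → ℚ
  f m = σ m k
  e = conv f logCoef n
  -- By `σ-rec` the two sequences add up, term by term, to the coefficients of y^(k-1), so the right
  -- side is the induction hypothesis for `n` at one power of y lower.
  lower : ∀ k → ℕ→ℚ k * σ (suc n) k ≡
    conv (θ (λ m → σ m k) ∘ suc) logCoef n + conv (θ (λ m → σ m k)) logCoef n
  lower zero = trans (*-zeroˡ (σ (suc n) 0)) (sym (cong₂ _+_
    (conv-0ˡ logCoef n (λ i → trans (cong (ℕ→ℚ (suc i) *_) (σ-suc-zero i)) (*-zeroʳ (ℕ→ℚ (suc i)))))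
    (conv-0ˡ logCoef n θσ-zero)))
    where
    θσ-zero : ∀ i → θ (λ m → σ m 0) i ≡ 0ℚ
    θσ-zero zero = refl
    θσ-zero (suc i) = trans (cong (ℕ→ℚ (suc i) *_) (σ-suc-zero i)) (*-zeroʳ (ℕ→ℚ (suc i)))
  lower (suc k) = trans (σ-derivative n k) (trans
    (conv-cong {g = logCoef} n (λ i _ → trans
      (solve 2 (λ a b → a := a :- b :+ b) refl (σ i k) (ℕ→ℚ i * σ i (suc k)))
      (cong (_+ ℕ→ℚ i * σ i (suc k)) (sym (σ-rec i k)))) (λ _ → refl))
    (conv-+ˡ (θ (λ m → σ m (suc k)) ∘ suc) (θ (λ m → σ m (suc k))) logCoef n))

-- The newest coefficient stands first in `gregRev`, so the zip pairs G_i(x) with g (n - i).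
sumQ-gregRev : ∀ x g n →
  sumQ (zipWith _*_ (gregRev x n) (applyUpTo g (length (gregRev x n)))) ≡ conv (λ m → G m x) g n
sumQ-gregRev x g zero = trans (+-identityʳ (1ℚ * g 0)) (sym (conv-zero (λ m → G m x) g))
sumQ-gregRev x g (suc n) = begin
  G (suc n) x * g 0 + sumQ (zipWith _*_ (gregRev x n) (applyUpTo (g ∘ suc) (length (gregRev x n))))
    ≡⟨ cong (G (suc n) x * g 0 +_) (sumQ-gregRev x (g ∘ suc) n) ⟩
  G (suc n) x * g 0 + conv (λ m → G m x) (g ∘ suc) n ≡⟨ +-comm (G (suc n) x * g 0) _ ⟩
  conv (λ m → G m x) (g ∘ suc) n + G (suc n) x * g 0 ≡⟨ conv-last (λ m → G m x) g n ⟨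
  conv (λ m → G m x) g (suc n) ∎
  where open ≡-Reasoning

G-suc : ∀ x n → G (suc n) x ≡ binomQ x (suc n) - conv (λ m → G m x) (logCoef ∘ suc) n
G-suc x n = cong (λ z → binomQ x (suc n) - z) (trans
  (cong (λ l → sumQ (zipWith _*_ (gregRev x n) l)) (map-applyUpTo id (logCoef ∘ suc) (length (gregRev x n))))
  (sumQ-gregRev x (logCoef ∘ suc) n))

-- the integral of y^k over [x, x + 1]
w : ℚ → ℕ → ℚ
w x k = (((x + 1ℚ) ^ℚ suc k) - (x ^ℚ suc k)) * inv (suc k)

-- Integrating `σ-derivative` over [x, x + 1] gives binom(x+1, n+1) - binom(x, n+1), which is
-- binom(x, n) by Pascal's rule. The integrals thus obey the recursion that defines G_n(x).
conv-Σσw : ∀ x N n → n < N → conv (λ m → Σ[ N ] (λ k → σ m k * w x k)) logCoef n ≡ binomQ x n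
conv-Σσw x N n n<N = begin
  conv (λ m → Σ[ N ] (λ k → σ m k * w x k)) logCoef n ≡⟨ Σ-conv N n σ (w x) logCoef ⟩
  Σ[ N ] (λ k → conv (λ m → σ m k) logCoef n * w x k) ≡⟨ Σ-cong N (λ k _ → pointwise k) ⟩
  Σ[ N ] (λ k → p k - q k) ≡⟨ Σ-minus N p q ⟩
  -- The constant coefficient, lost in differentiation, is put back into both sums so that each is a
  -- full evaluation.
  Σ[ N ] p - Σ[ N ] q ≡⟨ solve 3 (λ a b c → b :- c := (a :+ b) :- (a :+ c))
        refl (σ (suc n) 0 * 1ℚ) (Σ[ N ] p) (Σ[ N ] q) ⟩
  (σ (suc n) 0 * 1ℚ + Σ[ N ] p) - (σ (suc n) 0 * 1ℚ + Σ[ N ] q)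
    ≡⟨ cong₂ _-_ (trans (sym (Σ-suc N _)) (eval-σ (x + 1ℚ) (suc N) (suc n) (s≤s n<N)))
                 (trans (sym (Σ-suc N _)) (eval-σ x (suc N) (suc n) (s≤s n<N))) ⟩
  binomQ (x + 1ℚ) (suc n) - binomQ x (suc n) ≡⟨ cong (_- binomQ x (suc n)) (binomQ-Pascal x n) ⟩
  binomQ x (suc n) + binomQ x n - binomQ x (suc n) ≡⟨ solve 2 (λ a b → a :+ b :- a := b)
        refl (binomQ x (suc n)) (binomQ x n) ⟩
  binomQ x n ∎
  where
  open ≡-Reasoning
  p q : ℕ → ℚ
  p k = σ (suc n) (suc k) * ((x + 1ℚ) ^ℚ suc k)
  q k = σ (suc n) (suc k) * (x ^ℚ suc k)
  pointwise : ∀ k → conv (λ m → σ m k) logCoef n * w x k ≡ p k - q k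
  pointwise k = begin
    conv (λ m → σ m k) logCoef n * w x k ≡⟨ cong (_* w x k) (sym (σ-derivative n k)) ⟩
    ℕ→ℚ (suc k) * s * ((a - b) * i) ≡⟨ solve 5 (λ v s a b i → v :* s :* ((a :- b) :* i) := (v :* i) :* (s :* a :- s :* b))
          refl (ℕ→ℚ (suc k)) s a b i ⟩
    (ℕ→ℚ (suc k) * i) * (s * a - s * b) ≡⟨ cong (_* (s * a - s * b)) (ν*inv k) ⟩
    1ℚ * (s * a - s * b) ≡⟨ *-identityˡ _ ⟩
    s * a - s * b ∎
    where
    s = σ (suc n) (suc k)
    a = (x + 1ℚ) ^ℚ suc k
    b = x ^ℚ suc k
    i = inv (suc k)

-- Since `logCoef 0` is 1, the convolution equation determines its solution. The recursion reaches
-- all earlier indices, so `go` carries a bound `b` for strong induction.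
G-σ : ∀ x N n → n < N → G n x ≡ Σ[ N ] (λ k → σ n k * w x k)
G-σ x N n n<N = go (suc n) n ℕₚ.≤-refl n<N
  where
  I : ℕ → ℚ
  I m = Σ[ N ] (λ k → σ m k * w x k)
  go : ∀ b n → n < b → n < N → G n x ≡ I n
  go (suc b) zero _ n<N = sym (trans (sym (*-identityʳ (I 0)))
    (trans (sym (conv-zero I logCoef)) (conv-Σσw x N 0 n<N)))
  go (suc b) (suc n) (s≤s n<b) n<N = begin
    G (suc n) x ≡⟨ G-suc x n ⟩
    binomQ x (suc n) - conv (λ m → G m x) (logCoef ∘ suc) n
      ≡⟨ cong₂ _-_ (sym (conv-Σσw x N (suc n) n<N))
           (conv-cong {g = logCoef ∘ suc} n (λ i i≤n → go b i (ℕₚ.≤-trans (s≤s i≤n) n<b)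
             (ℕₚ.≤-trans (s≤s i≤n) (ℕₚ.<⇒≤ n<N))) (λ _ → refl)) ⟩
    conv I logCoef (suc n) - r ≡⟨ cong (_- r) (conv-last I logCoef n) ⟩
    r + I (suc n) * 1ℚ - r ≡⟨ solve 2 (λ r i → r :+ i :* con 1ℚ :- r := i) refl r (I (suc n)) ⟩
    I (suc n) ∎
    where
    open ≡-Reasoning
    r = conv I (logCoef ∘ suc) n

-- Binomial identities and signs

^-distribʳ-* : ∀ a b n → (a * b) ^ℚ n ≡ (a ^ℚ n) * (b ^ℚ n)
^-distribʳ-* a b zero = refl
^-distribʳ-* a b (suc n) = trans (cong (a * b *_) (^-distribʳ-* a b n))
  (solve 4 (λ a b c d → (a :* b) :* (c :* d) := (a :* c) :* (b :* d)) refl a b (a ^ℚ n) (b ^ℚ n))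

0^suc : ∀ n → 0ℚ ^ℚ suc n ≡ 0ℚ
0^suc n = *-zeroˡ (0ℚ ^ℚ n)

1^ : ∀ n → 1ℚ ^ℚ n ≡ 1ℚ
1^ zero = refl
1^ (suc n) = trans (*-identityˡ _) (1^ n)

sgn-+ : ∀ m n → sgn (m ℕ.+ n) ≡ sgn m * sgn n
sgn-+ zero n = sym (*-identityˡ (sgn n))
sgn-+ (suc m) n = trans (cong (- 1ℚ *_) (sgn-+ m n)) (sym (*-assoc (- 1ℚ) (sgn m) (sgn n)))

sgn² : ∀ n → sgn n * sgn n ≡ 1ℚ
sgn² n = trans (sym (^-distribʳ-* (- 1ℚ) (- 1ℚ) n)) (1^ n)

binomQ-n-suc : ∀ n → binomQ (ℕ→ℚ n) (suc n) ≡ 0ℚ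
binomQ-n-suc n = solve 3 (λ b v i → b :* (v :- v) :* i := con 0ℚ) refl (binomQ (ℕ→ℚ n) n) (ℕ→ℚ n) (inv (suc n))

binomQ-suc-Pascal : ∀ n k → binomQ (ℕ→ℚ (suc n)) (suc k) ≡ binomQ (ℕ→ℚ n) (suc k) + binomQ (ℕ→ℚ n) k
binomQ-suc-Pascal n k = trans (cong (λ y → binomQ y (suc k)) (trans (ν-suc n) (+-comm 1ℚ (ℕ→ℚ n)))) (binomQ-Pascal (ℕ→ℚ n) k)

binomQ-diagonal : ∀ n → binomQ (ℕ→ℚ n) n ≡ 1ℚ
binomQ-diagonal zero = refl
binomQ-diagonal (suc n) = trans (binomQ-suc-Pascal n n) (cong₂ _+_ (binomQ-n-suc n) (binomQ-diagonal n))

binomial-theorem : ∀ X n → Σ[ suc n ] (λ k → binomQ (ℕ→ℚ n) k * (X ^ℚ k)) ≡ (X + 1ℚ) ^ℚ n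
binomial-theorem X zero = trans (Σ-suc 0 _) (trans (cong (1ℚ * 1ℚ +_) (Σ-base _)) refl)
binomial-theorem X (suc n) = begin
  Σ[ suc (suc n) ] (λ k → binomQ (ℕ→ℚ (suc n)) k * (X ^ℚ k)) ≡⟨ Σ-suc (suc n) _ ⟩
  1ℚ * 1ℚ + Σ[ suc n ] (λ k → binomQ (ℕ→ℚ (suc n)) (suc k) * (X ^ℚ suc k))
    ≡⟨ cong (1ℚ * 1ℚ +_) (Σ-cong (suc n) (λ k _ → trans (cong (_* (X ^ℚ suc k)) (binomQ-suc-Pascal n k))
         (solve 4 (λ b b′ x p → (b′ :+ b) :* (x :* p) := b′ :* (x :* p) :+ x :* (b :* p)) refl
            (binomQ (ℕ→ℚ n) k) (binomQ (ℕ→ℚ n) (suc k)) X (X ^ℚ k)))) ⟩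
  1ℚ * 1ℚ + Σ[ suc n ] (λ k → f (suc k) + X * f k)
    ≡⟨ cong (1ℚ * 1ℚ +_) (trans (Σ-+ (suc n) (f ∘ suc) _) (cong₂ _+_ (Σ-last n (f ∘ suc)) (Σ-*ˡ (suc n) X f))) ⟩
  1ℚ * 1ℚ + (Σ[ n ] (f ∘ suc) + f (suc n) + X * Σ[ suc n ] f)
    ≡⟨ cong (λ z → 1ℚ * 1ℚ + (Σ[ n ] (f ∘ suc) + z * (X ^ℚ suc n) + X * Σ[ suc n ] f)) (binomQ-n-suc n) ⟩
  1ℚ * 1ℚ + (Σ[ n ] (f ∘ suc) + 0ℚ * (X ^ℚ suc n) + X * Σ[ suc n ] f)
    ≡⟨ solve 3 (λ s p t → con 1ℚ :* con 1ℚ :+ (s :+ con 0ℚ :* p :+ t) := t :+ (con 1ℚ :* con 1ℚ :+ s)) refl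
         (Σ[ n ] (f ∘ suc)) (X ^ℚ suc n) (X * Σ[ suc n ] f) ⟩
  X * Σ[ suc n ] f + (f 0 + Σ[ n ] (f ∘ suc)) ≡⟨ cong (X * Σ[ suc n ] f +_) (Σ-suc n f) ⟨
  X * Σ[ suc n ] f + Σ[ suc n ] f ≡⟨ solve 2 (λ x s → x :* s :+ s := (x :+ con 1ℚ) :* s) refl X (Σ[ suc n ] f) ⟩
  (X + 1ℚ) * Σ[ suc n ] f ≡⟨ cong ((X + 1ℚ) *_) (binomial-theorem X n) ⟩
  (X + 1ℚ) ^ℚ suc n ∎
  where
  open ≡-Reasoning
  f : ℕ → ℚ
  f k = binomQ (ℕ→ℚ n) k * (X ^ℚ k)

-- At y = p-1 this isolates the factor p of binom(p, k+1), which `Φ-frobenius` divides out.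
binomQ-absorption : ∀ y k → ℕ→ℚ (suc k) * binomQ (y + 1ℚ) (suc k) ≡ (y + 1ℚ) * binomQ y k
binomQ-absorption y zero = solve 1 (λ y → con 1ℚ :* (con 1ℚ :* (y :+ con 1ℚ :- con 0ℚ) :* con 1ℚ) := (y :+ con 1ℚ) :* con 1ℚ)
      refl y
binomQ-absorption y (suc k) = ν*-cancelˡ k (begin
  N * (ℕ→ℚ (suc (suc k)) * binomQ (y + 1ℚ) (suc (suc k))) ≡⟨ cong (N *_) (binomQ-rec (y + 1ℚ) (suc k)) ⟩
  N * (b * (y + 1ℚ - N)) ≡⟨ cong (λ v → N * (b * (y + 1ℚ - v))) (ν-suc k) ⟩
  N * (b * (y + 1ℚ - (1ℚ + ℕ→ℚ k)))
    ≡⟨ solve 4 (λ n b y v → n :* (b :* (y :+ con 1ℚ :- (con 1ℚ :+ v))) := (n :* b) :* (y :- v))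
          refl N b y (ℕ→ℚ k) ⟩
  (N * b) * (y - ℕ→ℚ k) ≡⟨ cong (_* (y - ℕ→ℚ k)) (binomQ-absorption y k) ⟩
  (y + 1ℚ) * binomQ y k * (y - ℕ→ℚ k) ≡⟨ *-assoc (y + 1ℚ) _ _ ⟩
  (y + 1ℚ) * (binomQ y k * (y - ℕ→ℚ k)) ≡⟨ cong ((y + 1ℚ) *_) (binomQ-rec y k) ⟨
  (y + 1ℚ) * (N * binomQ y (suc k)) ≡⟨ solve 3 (λ a n b → a :* (n :* b) := n :* (a :* b))
        refl (y + 1ℚ) N (binomQ y (suc k)) ⟩
  N * ((y + 1ℚ) * binomQ y (suc k)) ∎)
  where
  open ≡-Reasoning
  N = ℕ→ℚ (suc k)
  b = binomQ (y + 1ℚ) (suc k)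

-- Serves both as the exceptional value at x = -1 and, since p-1 ≡ -1, as the model for binom(p-1,
-- k) modulo p.
binomQ-neg1 : ∀ n → binomQ (- 1ℚ) n ≡ sgn n
binomQ-neg1 zero = refl
binomQ-neg1 (suc n) = begin
  binomQ (- 1ℚ) n * (- 1ℚ - ℕ→ℚ n) * inv (suc n) ≡⟨ cong (λ b → b * (- 1ℚ - ℕ→ℚ n) * inv (suc n)) (binomQ-neg1 n) ⟩
  sgn n * (- 1ℚ - ℕ→ℚ n) * inv (suc n)
    ≡⟨ solve 3 (λ s v i → s :* (:- con 1ℚ :- v) :* i := :- con 1ℚ :* ((con 1ℚ :+ v) :* (s :* i)))
          refl (sgn n) (ℕ→ℚ n) (inv (suc n)) ⟩
  - 1ℚ * ((1ℚ + ℕ→ℚ n) * (sgn n * inv (suc n))) ≡⟨ cong (λ v → - 1ℚ * (v * (sgn n * inv (suc n)))) (ν-suc n) ⟨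
  - 1ℚ * (ℕ→ℚ (suc n) * (sgn n * inv (suc n))) ≡⟨ cong (- 1ℚ *_) (ν*-inv-cancel n (sgn n)) ⟩
  sgn (suc n) ∎
  where open ≡-Reasoning

σ-diagonal : ∀ n → ℕ→ℚ (n !) * σ n n ≡ 1ℚ
σ-diagonal zero = refl
σ-diagonal (suc n) = begin
  ℕ→ℚ (suc n ℕ.* n !) * ((σ n n - ℕ→ℚ n * σ n (suc n)) * i)
    ≡⟨ cong₂ (λ a b → a * ((σ n n - ℕ→ℚ n * b) * i)) (ν-* (suc n) (n !)) (σ-zero (ℕₚ.n<1+n n)) ⟩
  ℕ→ℚ (suc n) * ℕ→ℚ (n !) * ((σ n n - ℕ→ℚ n * 0ℚ) * i)
    ≡⟨ solve 5 (λ a f s v i → a :* f :* ((s :- v :* con 0ℚ) :* i) := a :* ((f :* s) :* i)) refl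
         (ℕ→ℚ (suc n)) (ℕ→ℚ (n !)) (σ n n) (ℕ→ℚ n) i ⟩
  ℕ→ℚ (suc n) * ((ℕ→ℚ (n !) * σ n n) * i) ≡⟨ ν*-inv-cancel n _ ⟩
  ℕ→ℚ (n !) * σ n n ≡⟨ σ-diagonal n ⟩
  1ℚ ∎
  where
  open ≡-Reasoning
  i = inv (suc n)

even-or-sgn≡-1 : ∀ n → (2 ∣ n) ⊎ (sgn n ≡ - 1ℚ)
even-or-sgn≡-1 zero = inj₁ (2 ℕᵈ.∣0)
even-or-sgn≡-1 (suc zero) = inj₂ refl
even-or-sgn≡-1 (suc (suc n)) with even-or-sgn≡-1 n
... | inj₁ 2∣n = inj₁ (ℕᵈ.∣m∣n⇒∣m+n ℕᵈ.∣-refl 2∣n)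
... | inj₂ e = inj₂ (trans (cong (λ s → - 1ℚ * (- 1ℚ * s)) e) refl)

sgn-prime : ∀ {r} → Prime (3 ℕ.+ r) → sgn (3 ℕ.+ r) ≡ - 1ℚ
sgn-prime {r} pr with even-or-sgn≡-1 (3 ℕ.+ r)
... | inj₂ e = e
... | inj₁ 2∣p with prime⇒irreducible pr 2∣p
...   | inj₁ ()
...   | inj₂ ()

geometric : ∀ y n → (y + 1ℚ) * Σ[ n ] (λ k → sgn k * (y ^ℚ suc k)) ≡ y - sgn n * (y ^ℚ suc n)
geometric y zero = trans (cong ((y + 1ℚ) *_) (Σ-base _))
  (solve 1 (λ y → (y :+ con 1ℚ) :* con 0ℚ := y :- con 1ℚ :* (y :* con 1ℚ)) refl y)
geometric y (suc n) = begin
  (y + 1ℚ) * Σ[ suc n ] t ≡⟨ cong ((y + 1ℚ) *_) (Σ-last n t) ⟩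
  (y + 1ℚ) * (Σ[ n ] t + t n) ≡⟨ *-distribˡ-+ (y + 1ℚ) _ _ ⟩
  (y + 1ℚ) * Σ[ n ] t + (y + 1ℚ) * t n ≡⟨ cong (_+ (y + 1ℚ) * t n) (geometric y n) ⟩
  y - sgn n * (y ^ℚ suc n) + (y + 1ℚ) * (sgn n * (y ^ℚ suc n))
    ≡⟨ solve 3 (λ y s z → y :- s :* z :+ (y :+ con 1ℚ) :* (s :* z) := y :- (:- con 1ℚ :* s) :* (y :* z))
          refl y (sgn n) (y ^ℚ suc n) ⟩
  y - sgn (suc n) * (y ^ℚ suc (suc n)) ∎
  where
  open ≡-Reasoning
  t : ℕ → ℚ
  t k = sgn k * (y ^ℚ suc k)

-- Congruences modulo p between p-integral rationals

module Localization (p : ℕ) (pr : Prime p) where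

  -- The fraction need not be in lowest terms, so sums and products are formed with the product of
  -- the denominators and no gcd.
  record Integral (q : ℚ) : Set where
    constructor integral
    field
      den   : ℕ
      num   : ℤ
      p∤den : ¬ p ∣ den
      eq    : q * ℕ→ℚ den ≡ ι num

  private
    p∤1 : ¬ p ∣ 1
    p∤1 p∣1 = ℕₚ.<⇒≱ (ℕ.nonTrivial⇒n>1 p {{prime⇒nonTrivial pr}}) (ℕᵈ.∣⇒≤ p∣1)

    p∤* : ∀ {m n} → ¬ p ∣ m → ¬ p ∣ n → ¬ p ∣ m ℕ.* n
    p∤* {m} {n} p∤m p∤n p∣mn with euclidsLemma m n pr p∣mn
    ... | inj₁ p∣m = p∤m p∣m
    ... | inj₂ p∣n = p∤n p∣n

  Integral-ι : ∀ i → Integral (ι i)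
  Integral-ι i = integral 1 i p∤1 (*-identityʳ (ι i))

  Integral-ν : ∀ n → Integral (ℕ→ℚ n)
  Integral-ν n = Integral-ι (pos n)

  Integral-+ : ∀ {a b} → Integral a → Integral b → Integral (a + b)
  Integral-+ {a} {b} (integral d m p∤d e) (integral d′ n p∤d′ e′) =
    integral (d ℕ.* d′) (m ℤ.* pos d′ ℤ.+ n ℤ.* pos d) (p∤* p∤d p∤d′) (begin
      (a + b) * ℕ→ℚ (d ℕ.* d′) ≡⟨ cong ((a + b) *_) (ν-* d d′) ⟩
      (a + b) * (ℕ→ℚ d * ℕ→ℚ d′)
        ≡⟨ solve 4 (λ a b d d′ → (a :+ b) :* (d :* d′) := a :* d :* d′ :+ b :* d′ :* d) refl a b (ℕ→ℚ d) (ℕ→ℚ d′) ⟩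
      a * ℕ→ℚ d * ℕ→ℚ d′ + b * ℕ→ℚ d′ * ℕ→ℚ d ≡⟨ cong₂ (λ u v → u * ℕ→ℚ d′ + v * ℕ→ℚ d) e e′ ⟩
      ι m * ℕ→ℚ d′ + ι n * ℕ→ℚ d ≡⟨ cong₂ _+_ (ι-* m (pos d′)) (ι-* n (pos d)) ⟨
      ι (m ℤ.* pos d′) + ι (n ℤ.* pos d) ≡⟨ ι-+ (m ℤ.* pos d′) (n ℤ.* pos d) ⟨
      ι (m ℤ.* pos d′ ℤ.+ n ℤ.* pos d) ∎)
    where open ≡-Reasoning

  Integral-* : ∀ {a b} → Integral a → Integral b → Integral (a * b)
  Integral-* {a} {b} (integral d m p∤d e) (integral d′ n p∤d′ e′) =
    integral (d ℕ.* d′) (m ℤ.* n) (p∤* p∤d p∤d′) (begin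
      (a * b) * ℕ→ℚ (d ℕ.* d′) ≡⟨ cong ((a * b) *_) (ν-* d d′) ⟩
      (a * b) * (ℕ→ℚ d * ℕ→ℚ d′)
        ≡⟨ solve 4 (λ a b d d′ → (a :* b) :* (d :* d′) := (a :* d) :* (b :* d′)) refl a b (ℕ→ℚ d) (ℕ→ℚ d′) ⟩
      (a * ℕ→ℚ d) * (b * ℕ→ℚ d′) ≡⟨ cong₂ _*_ e e′ ⟩
      ι m * ι n ≡⟨ ι-* m n ⟨
      ι (m ℤ.* n) ∎)
    where open ≡-Reasoning

  Integral-neg : ∀ {a} → Integral a → Integral (- a)
  Integral-neg {a} ia = subst Integral (solve 1 (λ a → :- con 1ℚ :* a := :- a) refl a)
    (Integral-* (Integral-ι -[1+ 0 ]) ia)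

  Integral-minus : ∀ {a b} → Integral a → Integral b → Integral (a - b)
  Integral-minus ia ib = Integral-+ ia (Integral-neg ib)

  Integral-^ : ∀ {a} n → Integral a → Integral (a ^ℚ n)
  Integral-^ zero ia = Integral-ν 1
  Integral-^ (suc n) ia = Integral-* ia (Integral-^ n ia)

  Integral-sgn : ∀ n → Integral (sgn n)
  Integral-sgn n = Integral-^ n (Integral-ι -[1+ 0 ])

  Integral-Σ : ∀ n {f} → (∀ i → i < n → Integral (f i)) → Integral (Σ[ n ] f)
  Integral-Σ zero h = subst Integral (sym (Σ-base _)) (Integral-ν 0)
  Integral-Σ (suc n) h = subst Integral (sym (Σ-suc n _))
    (Integral-+ (h 0 (s≤s z≤n)) (Integral-Σ n (λ i i<n → h (suc i) (s≤s i<n))))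

  Integral-inv : ∀ {n} → ¬ p ∣ suc n → Integral (inv (suc n))
  Integral-inv {n} p∤n = integral (suc n) (pos 1) p∤n (trans (*-comm (inv (suc n)) (ℕ→ℚ (suc n))) (ν*inv n))

  ∤-< : ∀ {n} → suc n < p → ¬ p ∣ suc n
  ∤-< n<p p∣n = ℕₚ.<⇒≱ n<p (ℕᵈ.∣⇒≤ p∣n)

  Integral-inv-< : ∀ {n} → suc n < p → Integral (inv (suc n))
  Integral-inv-< n<p = Integral-inv (∤-< n<p)

  Integral-conv : ∀ {f g} n → (∀ i → i ≤ n → Integral (f i)) → (∀ i → i ≤ n → Integral (g i)) → Integral (conv f g n)
  Integral-conv {f} {g} n hf hg = subst Integral (sym (conv-def f g n))
    (Integral-Σ (suc n) (λ i i<n → Integral-* (hf i (ℕₚ.≤-pred i<n)) (hg (n ∸ i) (ℕₚ.m∸n≤m n i))))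

  infix 4 _≈_
  -- Only the difference is constrained: `a` and `b` may both have a pole at p. Hence a multiplier
  -- must be p-integral, while the two sides it multiplies need not be.
  record _≈_ (a b : ℚ) : Set where
    constructor congruent
    field
      quotient   : ℚ
      integrality : Integral quotient
      eq : a - b ≡ ℕ→ℚ p * quotient

  ≈-reflexive : ∀ {a b} → a ≡ b → a ≈ b
  ≈-reflexive {a} refl = congruent 0ℚ (Integral-ν 0)
    (solve 2 (λ a p → a :- a := p :* con 0ℚ) refl a (ℕ→ℚ p))

  ≈-refl : ∀ {a} → a ≈ a
  ≈-refl = ≈-reflexive refl

  +-cong : ∀ {a b c d} → a ≈ b → c ≈ d → a + c ≈ b + d
  +-cong {a} {b} {c} {d} (congruent q iq e) (congruent r ir e′) = congruent (q + r) (Integral-+ iq ir)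
    (trans (solve 4 (λ a b c d → (a :+ c) :- (b :+ d) := (a :- b) :+ (c :- d)) refl a b c d)
      (trans (cong₂ _+_ e e′) (sym (*-distribˡ-+ (ℕ→ℚ p) q r))))

  *-congˡ : ∀ {a b c} → Integral c → a ≈ b → c * a ≈ c * b
  *-congˡ {a} {b} {c} ic (congruent q iq e) = congruent (c * q) (Integral-* ic iq)
    (trans (solve 3 (λ a b c → c :* a :- c :* b := c :* (a :- b)) refl a b c)
      (trans (cong (c *_) e) (solve 3 (λ c p q → c :* (p :* q) := p :* (c :* q)) refl c (ℕ→ℚ p) q)))

  *-congʳ : ∀ {a b c} → Integral c → a ≈ b → a * c ≈ b * c
  *-congʳ {a} {b} {c} ic e = subst₂ _≈_ (*-comm c a) (*-comm c b) (*-congˡ ic e)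

  neg-cong : ∀ {a b} → a ≈ b → - a ≈ - b
  neg-cong {a} {b} e = subst₂ _≈_ (lem a) (lem b) (*-congˡ (Integral-ι -[1+ 0 ]) e)
    where
    lem : ∀ a → - 1ℚ * a ≡ - a
    lem = solve 1 (λ a → :- con 1ℚ :* a := :- a) refl

  minus-cong : ∀ {a b c d} → a ≈ b → c ≈ d → a - c ≈ b - d
  minus-cong e e′ = +-cong e (neg-cong e′)

  ≈-sym : ∀ {a b} → a ≈ b → b ≈ a
  ≈-sym {a} {b} (congruent q iq e) = congruent (- q) (Integral-neg iq)
    (trans (solve 2 (λ a b → b :- a := :- (a :- b)) refl a b)
      (trans (cong -_ e) (solve 2 (λ p q → :- (p :* q) := p :* (:- q)) refl (ℕ→ℚ p) q)))

  ≈-trans : ∀ {a b c} → a ≈ b → b ≈ c → a ≈ c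
  ≈-trans {a} {b} {c} (congruent q iq e) (congruent r ir e′) = congruent (q + r) (Integral-+ iq ir)
    (trans (solve 3 (λ a b c → a :- c := (a :- b) :+ (b :- c)) refl a b c)
      (trans (cong₂ _+_ e e′) (sym (*-distribˡ-+ (ℕ→ℚ p) q r))))

  ≈-setoid : Setoid 0ℓ 0ℓ
  ≈-setoid = record { Carrier = ℚ ; _≈_ = _≈_
    ; isEquivalence = record { refl = ≈-refl ; sym = ≈-sym ; trans = ≈-trans } }

  p*≈0 : ∀ {a} → Integral a → ℕ→ℚ p * a ≈ 0ℚ
  p*≈0 {a} ia = congruent a ia (+-identityʳ _)

  Σ-cong-≈ : ∀ n {f g} → (∀ i → i < n → f i ≈ g i) → Σ[ n ] f ≈ Σ[ n ] g
  Σ-cong-≈ zero h = ≈-reflexive (trans (Σ-base _) (sym (Σ-base _)))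
  Σ-cong-≈ (suc n) h = subst₂ _≈_ (sym (Σ-suc n _)) (sym (Σ-suc n _))
    (+-cong (h 0 (s≤s z≤n)) (Σ-cong-≈ n (λ i i<n → h (suc i) (s≤s i<n))))

  ν*-cancel-≈ : ∀ {n a b} → ¬ p ∣ suc n → ℕ→ℚ (suc n) * a ≈ ℕ→ℚ (suc n) * b → a ≈ b
  ν*-cancel-≈ {n} {a} {b} p∤n e = subst₂ _≈_ (inv-cancelˡ n a) (inv-cancelˡ n b) (*-congˡ (Integral-inv p∤n) e)

  -- Clearing denominators in z = p q with q = n/d gives `↥ z` d = p n `↧ z`. As p divides the left
  -- side and not d, it divides `↥ z`.
  ≈⇒∣↥ : ∀ {a b} → a ≈ b → p ∣ ℤ.∣ ↥ (a - b) ∣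
  ≈⇒∣↥ {a} {b} (congruent q (integral d n p∤d e′) e) with euclidsLemma _ d pr p∣zd
    where
    z = a - b
    lem : ↥ z ℤ.* pos d ≡ pos p ℤ.* n ℤ.* ↧ z
    lem = ι-injective (begin
      ι (↥ z ℤ.* pos d) ≡⟨ ι-* (↥ z) (pos d) ⟩
      ι (↥ z) * ℕ→ℚ d ≡⟨ cong (_* ℕ→ℚ d) (sym (*-↧ z)) ⟩
      z * ι (↧ z) * ℕ→ℚ d ≡⟨ cong (λ u → u * ι (↧ z) * ℕ→ℚ d) e ⟩
      ℕ→ℚ p * q * ι (↧ z) * ℕ→ℚ d
        ≡⟨ solve 4 (λ p q u d → p :* q :* u :* d := p :* (q :* d) :* u) refl (ℕ→ℚ p) q (ι (↧ z)) (ℕ→ℚ d) ⟩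
      ℕ→ℚ p * (q * ℕ→ℚ d) * ι (↧ z) ≡⟨ cong (λ u → ℕ→ℚ p * u * ι (↧ z)) e′ ⟩
      ℕ→ℚ p * ι n * ι (↧ z) ≡⟨ cong (_* ι (↧ z)) (sym (ι-* (pos p) n)) ⟩
      ι (pos p ℤ.* n) * ι (↧ z) ≡⟨ ι-* (pos p ℤ.* n) (↧ z) ⟨
      ι (pos p ℤ.* n ℤ.* ↧ z) ∎)
      where open ≡-Reasoning
    p∣zd : p ∣ ℤ.∣ ↥ z ∣ ℕ.* d
    p∣zd = subst (p ∣_) (trans (sym (trans (cong ℤ.∣_∣ lem) (trans (ℤₚ.abs-* (pos p ℤ.* n) (↧ z))
        (cong (ℕ._* ↧ₙ z) (ℤₚ.abs-* (pos p) n))))) (ℤₚ.abs-* (↥ z) (pos d)))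
      (ℕᵈ.∣m⇒∣m*n (↧ₙ z) (ℕᵈ.m∣m*n ℤ.∣ n ∣))
  ... | inj₁ p∣z = p∣z
  ... | inj₂ p∣d = contradiction p∣d p∤d

-- The coefficients of binom(y, p-1) modulo p

-- Writing p as 3 + r excludes 2, so that (-1)^(p-1) = 1, and lets p-1 and p-2 compute to
-- successors.
module OddPrime (r : ℕ) (pr : Prime (3 ℕ.+ r)) where

  q p : ℕ
  q = 2 ℕ.+ r
  p = suc q

  open Localization p pr public

  P : ℚ
  P = ℕ→ℚ p

  q<p : q < p
  q<p = ℕₚ.n<1+n q

  sgn-pred : sgn q ≡ 1ℚ
  sgn-pred = trans (solve 1 (λ s → s := :- con 1ℚ :* (:- con 1ℚ :* s))
        refl (sgn q)) (cong (- 1ℚ *_) (sgn-prime pr))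

  sgn-pred-pred : sgn (suc r) ≡ - 1ℚ
  sgn-pred-pred = trans (solve 1 (λ s → s := :- con 1ℚ :* (:- con 1ℚ :* s))
        refl (sgn (suc r))) (cong (- 1ℚ *_) sgn-pred)

  νq≈-1 : ℕ→ℚ q ≈ - 1ℚ
  νq≈-1 = congruent 1ℚ (Integral-ν 1)
    (trans (solve 1 (λ v → v :- (:- con 1ℚ) := (con 1ℚ :+ v) :* con 1ℚ)
          refl (ℕ→ℚ q)) (cong (_* 1ℚ) (sym (ν-suc q))))

  Integral-binomQ : ∀ {y} n → n < p → Integral y → Integral (binomQ y n)
  Integral-binomQ zero _ iy = Integral-ν 1
  Integral-binomQ (suc n) n<p iy =
    Integral-* (Integral-* (Integral-binomQ n (ℕₚ.<⇒≤ n<p) iy) (Integral-minus iy (Integral-ν n))) (Integral-inv-< n<p)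

  Integral-σ : ∀ n k → n < p → Integral (σ n k)
  Integral-σ zero zero _ = Integral-ν 1
  Integral-σ zero (suc k) _ = Integral-ν 0
  Integral-σ (suc n) zero n<p =
    Integral-* (Integral-neg (Integral-* (Integral-ν n) (Integral-σ n zero (ℕₚ.<⇒≤ n<p)))) (Integral-inv-< n<p)
  Integral-σ (suc n) (suc k) n<p = Integral-* (Integral-minus (Integral-σ n k (ℕₚ.<⇒≤ n<p))
    (Integral-* (Integral-ν n) (Integral-σ n (suc k) (ℕₚ.<⇒≤ n<p)))) (Integral-inv-< n<p)

  Integral-logCoef : ∀ {m} → suc m < p → Integral (logCoef m)
  Integral-logCoef {m} m<p = Integral-* (Integral-sgn m) (Integral-inv-< m<p)

  Integral-w : ∀ {x k} → suc k < p → Integral x → Integral (w x k)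
  Integral-w {x} {k} k<p ix = Integral-* (Integral-minus (Integral-^ (suc k) (Integral-+ ix (Integral-ν 1)))
    (Integral-^ (suc k) ix)) (Integral-inv-< k<p)

  -- The integral formula for G_n(x) has denominators up to n + 1; p enters at n = p-1.
  Integral-G : ∀ {x} n → n < q → Integral x → Integral (G n x)
  Integral-G {x} n n<q ix = subst Integral (sym (G-σ x (suc n) n ℕₚ.≤-refl))
    (Integral-Σ (suc n) (λ i i≤n → Integral-* (Integral-σ n i (ℕₚ.<⇒≤ (s≤s n<q)))
      (Integral-w (s≤s (ℕₚ.≤-trans i≤n n<q)) ix)))

  -- In the convolution for σ p only the constant term of log(1+t)/t paired with t^(p-1) has p in a
  -- denominator, and σ 0 (suc k) kills it.
  pσ≈0 : ∀ k → suc (suc k) < p → P * σ p (suc (suc k)) ≈ 0ℚ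
  pσ≈0 k k<p = ν*-cancel-≈ (∤-< k<p) (begin
    K * (P * σ p (suc (suc k))) ≡⟨ solve 3 (λ k p s → k :* (p :* s) := p :* (k :* s))
          refl K P (σ p (suc (suc k))) ⟩
    P * (K * σ p (suc (suc k))) ≡⟨ cong (P *_) (trans (σ-derivative q (suc k)) (conv-head f logCoef (suc r))) ⟩
    P * (0ℚ * logCoef q + conv (f ∘ suc) logCoef (suc r))
      ≡⟨ solve 3 (λ p l c → p :* (con 0ℚ :* l :+ c) := p :* c)
            refl P (logCoef q) (conv (f ∘ suc) logCoef (suc r)) ⟩
    P * conv (f ∘ suc) logCoef (suc r)
      ≈⟨ p*≈0 (Integral-conv (suc r) (λ i i≤r → Integral-σ (suc i) (suc k) (s≤s (s≤s i≤r)))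
                                     (λ i i≤r → Integral-logCoef (s≤s (s≤s i≤r)))) ⟩
    0ℚ ≡⟨ *-zeroʳ K ⟨
    K * 0ℚ ∎)
    where
    open SetoidReasoning ≈-setoid
    K = ℕ→ℚ (suc (suc k))
    f : ℕ → ℚ
    f m = σ m (suc k)

  -- The coefficient of y is (-1)^(p-2)/(p-1) ≡ 1. In `σ-rec` at n = p-1 the left side vanishes
  -- modulo p by `pσ≈0`, and -(p-1) ≡ 1, so consecutive coefficients are opposite.
  σ-pred≈sgn : ∀ k → k < q → σ q (suc k) ≈ sgn k
  σ-pred≈sgn zero _ = begin
    σ q 1 ≡⟨ *-identityˡ (σ q 1) ⟨
    1ℚ * σ q 1 ≡⟨ trans (σ-derivative (suc r) 0) (conv-head (λ m → σ m 0) logCoef r) ⟩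
    1ℚ * logCoef (suc r) + conv (λ m → σ (suc m) 0) logCoef r
      ≡⟨ cong (1ℚ * logCoef (suc r) +_) (conv-0ˡ logCoef r σ-suc-zero) ⟩
    1ℚ * (sgn (suc r) * inv q) + 0ℚ
      ≡⟨ cong (λ s → 1ℚ * (s * inv q) + 0ℚ) sgn-pred-pred ⟩
    1ℚ * (- 1ℚ * inv q) + 0ℚ ≡⟨ solve 1 (λ i → con 1ℚ :* (:- con 1ℚ :* i) :+ con 0ℚ := :- con 1ℚ :* i)
          refl (inv q) ⟩
    - 1ℚ * inv q ≈⟨ *-congʳ (Integral-inv-< q<p) νq≈-1 ⟨
    ℕ→ℚ q * inv q ≡⟨ ν*inv (suc r) ⟩
    1ℚ ∎
    where open SetoidReasoning ≈-setoid
  σ-pred≈sgn (suc k) k<q = begin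
    σ q (suc (suc k)) ≡⟨ solve 2 (λ s u → s := (u :- (:- con 1ℚ) :* s) :- u)
          refl (σ q (suc (suc k))) (σ q (suc k)) ⟩
    (σ q (suc k) - - 1ℚ * σ q (suc (suc k))) - σ q (suc k)
      ≈⟨ minus-cong (minus-cong (≈-refl {σ q (suc k)}) (*-congʳ (Integral-σ q (suc (suc k)) q<p) νq≈-1)) (≈-refl {σ q (suc k)}) ⟨
    (σ q (suc k) - ℕ→ℚ q * σ q (suc (suc k))) - σ q (suc k) ≡⟨ cong (_- σ q (suc k)) (σ-rec q (suc k)) ⟨
    P * σ p (suc (suc k)) - σ q (suc k) ≈⟨ minus-cong (pσ≈0 k (s≤s k<q)) (σ-pred≈sgn k (ℕₚ.<⇒≤ k<q)) ⟩
    0ℚ - sgn k ≡⟨ solve 1 (λ s → con 0ℚ :- s := :- con 1ℚ :* s) refl (sgn k) ⟩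
    sgn (suc k) ∎
    where open SetoidReasoning ≈-setoid

  σ-pred-pred≈-1 : σ q q ≈ - 1ℚ
  σ-pred-pred≈-1 = ≈-trans (σ-pred≈sgn (suc r) ℕₚ.≤-refl) (≈-reflexive sgn-pred-pred)

  -- Wilson's and Fermat's theorems

  wilson : ℕ→ℚ (q !) ≈ - 1ℚ
  wilson = begin
    F ≡⟨ solve 1 (λ f → f := :- (f :* (:- con 1ℚ))) refl F ⟩
    -- The leading coefficient of binom(y, p-1) is known twice: as 1/(p-1)! exactly, and as -1
    -- modulo p.
    - (F * - 1ℚ) ≈⟨ neg-cong (*-congˡ (Integral-ν (q !)) σ-pred-pred≈-1) ⟨
    - (F * σ q q) ≡⟨ cong -_ (σ-diagonal q) ⟩
    - 1ℚ ∎
    where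
    open SetoidReasoning ≈-setoid
    F = ℕ→ℚ (q !)

  -- Modulo p the coefficients alternate between 1 and -1, so binom(y, p-1) is a geometric sum that
  -- the factor y + 1 telescopes.
  binomQ-pred : ∀ {y} → Integral y → (y + 1ℚ) * binomQ y q ≈ y - (y ^ℚ p)
  binomQ-pred {y} iy = begin
    (y + 1ℚ) * binomQ y q ≡⟨ cong ((y + 1ℚ) *_) (sym (eval-σ y p q q<p)) ⟩
    (y + 1ℚ) * Σ[ p ] (λ k → σ q k * (y ^ℚ k)) ≡⟨ cong ((y + 1ℚ) *_) (trans (Σ-suc q _)
        (trans (cong (λ z → z * 1ℚ + t) (σ-suc-zero (suc r))) (+-identityˡ t))) ⟩
    (y + 1ℚ) * t ≈⟨ *-congˡ (Integral-+ iy (Integral-ν 1)) (Σ-cong-≈ q (λ k k<q → *-congʳ (Integral-^ (suc k) iy) (σ-pred≈sgn k k<q))) ⟩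
    (y + 1ℚ) * Σ[ q ] (λ k → sgn k * (y ^ℚ suc k)) ≡⟨ geometric y q ⟩
    y - sgn q * (y ^ℚ p) ≡⟨ cong (λ s → y - s * (y ^ℚ p)) sgn-pred ⟩
    y - 1ℚ * (y ^ℚ p) ≡⟨ cong (λ z → y - z) (*-identityˡ (y ^ℚ p)) ⟩
    y - (y ^ℚ p) ∎
    where
    open SetoidReasoning ≈-setoid
    t : ℚ
    t = Σ[ q ] (λ k → σ q (suc k) * (y ^ℚ suc k))

  p*binomQ : ∀ {y} → Integral y → P * binomQ y p ≈ y - (y ^ℚ p)
  p*binomQ {y} iy = begin
    P * binomQ y p ≡⟨ binomQ-rec y q ⟩
    binomQ y q * (y - ℕ→ℚ q) ≈⟨ *-congˡ (Integral-binomQ q q<p iy) (minus-cong (≈-refl {y}) νq≈-1) ⟩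
    binomQ y q * (y - - 1ℚ) ≡⟨ solve 2 (λ b y → b :* (y :- (:- con 1ℚ)) := (y :+ con 1ℚ) :* b)
          refl (binomQ y q) y ⟩
    (y + 1ℚ) * binomQ y q ≈⟨ binomQ-pred iy ⟩
    y - (y ^ℚ p) ∎
    where open SetoidReasoning ≈-setoid

  -- y - y^p is periodic with period 1 by Pascal's rule for binom(y, p).
  fermat-step : ∀ {y} → Integral y → (y + 1ℚ) - ((y + 1ℚ) ^ℚ p) ≈ y - (y ^ℚ p)
  fermat-step {y} iy = begin
    (y + 1ℚ) - ((y + 1ℚ) ^ℚ p) ≈⟨ p*binomQ (Integral-+ iy (Integral-ν 1)) ⟨
    P * binomQ (y + 1ℚ) p ≡⟨ cong (P *_) (binomQ-Pascal y q) ⟩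
    P * (binomQ y p + binomQ y q) ≡⟨ *-distribˡ-+ P _ _ ⟩
    P * binomQ y p + P * binomQ y q ≈⟨ +-cong (p*binomQ iy) (p*≈0 (Integral-binomQ q q<p iy)) ⟩
    y - (y ^ℚ p) + 0ℚ ≡⟨ +-identityʳ _ ⟩
    y - (y ^ℚ p) ∎
    where open SetoidReasoning ≈-setoid

  fermat-0 : 0ℚ - (0ℚ ^ℚ p) ≈ 0ℚ
  fermat-0 = ≈-reflexive (cong (λ z → 0ℚ - z) (0^suc q))

  fermat-ν : ∀ n → ℕ→ℚ n - (ℕ→ℚ n ^ℚ p) ≈ 0ℚ
  fermat-ν zero = fermat-0
  fermat-ν (suc n) = subst (λ y → y - (y ^ℚ p) ≈ 0ℚ) (sym (trans (ν-suc n) (+-comm 1ℚ (ℕ→ℚ n))))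
    (≈-trans (fermat-step (Integral-ν n)) (fermat-ν n))

  fermat-neg : ∀ n → - ℕ→ℚ n - ((- ℕ→ℚ n) ^ℚ p) ≈ 0ℚ
  fermat-neg zero = fermat-0
  fermat-neg (suc n) = ≈-trans (≈-sym (fermat-step (Integral-neg (Integral-ν (suc n)))))
    (subst (λ y → y - (y ^ℚ p) ≈ 0ℚ) (sym (trans (cong (λ z → - z + 1ℚ) (ν-suc n))
      (solve 1 (λ v → :- (con 1ℚ :+ v) :+ con 1ℚ := :- v) refl (ℕ→ℚ n)))) (fermat-neg n))

  fermat-ι : ∀ i → ι i - (ι i ^ℚ p) ≈ 0ℚ
  fermat-ι (pos n) = fermat-ν n
  fermat-ι -[1+ n ] = fermat-neg (suc n)

  -- With D the denominator, D y^p ≡ D^p y^p = (D y)^p ≡ D y by the integer case, and D cancels.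
  fermat : ∀ {y} → Integral y → y ^ℚ p ≈ y
  fermat {y} iy@(integral zero n p∤0 e) = contradiction (p ℕᵈ.∣0) p∤0
  fermat {y} iy@(integral (suc d) n p∤d e) = ν*-cancel-≈ p∤d (begin
    D * (y ^ℚ p) ≈⟨ *-congʳ (Integral-^ p iy) (flip D (D ^ℚ p) (fermat-ν (suc d))) ⟩
    (D ^ℚ p) * (y ^ℚ p) ≡⟨ ^-distribʳ-* D y p ⟨
    (D * y) ^ℚ p ≡⟨ cong (_^ℚ p) Dy ⟩
    ι n ^ℚ p ≈⟨ flip (ι n) (ι n ^ℚ p) (fermat-ι n) ⟨
    ι n ≡⟨ Dy ⟨
    D * y ∎)
    where
    open SetoidReasoning ≈-setoid
    D = ℕ→ℚ (suc d)
    Dy : D * y ≡ ι n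
    Dy = trans (*-comm D y) e
    flip : ∀ a b → a - b ≈ 0ℚ → a ≈ b
    flip a b h = subst₂ _≈_ (solve 2 (λ a b → a :- b :+ b := a) refl a b) (+-identityˡ b) (+-cong h (≈-refl {b}))

  -- Replacing p-1 by -1 factor by factor is legitimate because all denominators stay below p.
  binomQ-q : ∀ k → k < p → binomQ (ℕ→ℚ q) k ≈ sgn k
  binomQ-q zero _ = ≈-refl
  binomQ-q (suc k) k<p = begin
    binomQ (ℕ→ℚ q) k * (ℕ→ℚ q - ℕ→ℚ k) * inv (suc k)
      ≈⟨ *-congʳ (Integral-inv-< k<p) (≈-trans
           (*-congʳ (Integral-minus (Integral-ν q) (Integral-ν k)) (binomQ-q k (ℕₚ.<⇒≤ k<p)))
           (*-congˡ (Integral-sgn k) (minus-cong νq≈-1 (≈-refl {ℕ→ℚ k})))) ⟩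
    sgn k * (- 1ℚ - ℕ→ℚ k) * inv (suc k) ≡⟨ cong (λ b → b * (- 1ℚ - ℕ→ℚ k) * inv (suc k)) (binomQ-neg1 k) ⟨
    binomQ (- 1ℚ) (suc k) ≡⟨ binomQ-neg1 (suc k) ⟩
    sgn (suc k) ∎
    where open SetoidReasoning ≈-setoid

  -- Truncated logarithms and G_{p-1}(x)

  Φ : ℚ → ℚ
  Φ X = Σ[ q ] (λ k → sgn k * ((X ^ℚ suc k) * inv (suc k)))

  P*inv : ∀ a → P * a * inv p ≡ a
  P*inv a = trans (solve 3 (λ p a i → p :* a :* i := p :* (a :* i)) refl P a (inv p)) (ν*-inv-cancel q a)

  -- C(p, j)/p = C(p-1, j-1)/j ≡ (-1)^(j-1)/j.
  Φ-frobenius : ∀ {X} → Integral X → (((X + 1ℚ) ^ℚ p) - (X ^ℚ p) - 1ℚ) * inv p ≈ Φ X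
  Φ-frobenius {X} iX = begin
    (((X + 1ℚ) ^ℚ p) - (X ^ℚ p) - 1ℚ) * inv p
      ≡⟨ cong (λ z → (z - (X ^ℚ p) - 1ℚ) * inv p) expand ⟩
    (1ℚ * 1ℚ + (P * t + 1ℚ * (X ^ℚ p)) - (X ^ℚ p) - 1ℚ) * inv p
      ≡⟨ cong (_* inv p) (solve 2 (λ t x → con 1ℚ :* con 1ℚ :+ (t :+ con 1ℚ :* x) :- x :- con 1ℚ := t)
            refl (P * t) (X ^ℚ p)) ⟩
    P * t * inv p ≡⟨ P*inv t ⟩
    t ≈⟨ Σ-cong-≈ q (λ k k<q → *-congʳ (Integral-* (Integral-^ (suc k) iX) (Integral-inv-< (s≤s k<q)))
           (binomQ-q k (ℕₚ.<⇒≤ (s≤s k<q)))) ⟩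
    Φ X ∎
    where
    open SetoidReasoning ≈-setoid
    u : ℕ → ℚ
    u k = binomQ (ℕ→ℚ q) k * ((X ^ℚ suc k) * inv (suc k))
    t = Σ[ q ] u
    term : ∀ k → binomQ P (suc k) * (X ^ℚ suc k) ≡ P * u k
    term k = ν*-cancelˡ k (E.begin
      K * (binomQ P (suc k) * z) E.≡⟨ *-assoc K _ z ⟨
      K * binomQ P (suc k) * z
        E.≡⟨ cong (_* z) (subst (λ y → K * binomQ y (suc k) ≡ y * binomQ (ℕ→ℚ q) k)
              (sym (trans (ν-suc q) (+-comm 1ℚ (ℕ→ℚ q)))) (binomQ-absorption (ℕ→ℚ q) k)) ⟩
      P * binomQ (ℕ→ℚ q) k * z E.≡⟨ cong (P * binomQ (ℕ→ℚ q) k *_) (ν*-inv-cancel k z) ⟨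
      P * binomQ (ℕ→ℚ q) k * (K * (z * inv (suc k)))
        E.≡⟨ solve 4 (λ p b k z → p :* b :* (k :* z) := k :* (p :* (b :* z)))
              refl P (binomQ (ℕ→ℚ q) k) K (z * inv (suc k)) ⟩
      K * (P * u k) E.∎)
      where
      module E = ≡-Reasoning
      K = ℕ→ℚ (suc k)
      z = X ^ℚ suc k
    expand : (X + 1ℚ) ^ℚ p ≡ 1ℚ * 1ℚ + (P * t + 1ℚ * (X ^ℚ p))
    expand = trans (sym (binomial-theorem X p)) (trans (Σ-suc p _) (cong (1ℚ * 1ℚ +_) (trans (Σ-last q _)
      (cong₂ _+_ (trans (Σ-cong q (λ k _ → term k)) (Σ-*ˡ q P u)) (cong (_* (X ^ℚ p)) (binomQ-diagonal p))))))

  Σ-sgn-w : ∀ x → Σ[ q ] (λ k → sgn k * w x k) ≡ Φ (x + 1ℚ) - Φ x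
  Σ-sgn-w x = trans (Σ-cong q (λ k _ → solve 4 (λ s a b i → s :* ((a :- b) :* i)
        := s :* (a :* i) :- s :* (b :* i)) refl
      (sgn k) ((x + 1ℚ) ^ℚ suc k) (x ^ℚ suc k) (inv (suc k))))
    (Σ-minus q _ _)

  G-pred : ∀ {x} → Integral x → G q x ≈ 1ℚ - (Φ (x + 1ℚ) - Φ x) + σ q q * w x q
  G-pred {x} ix = begin
    G q x ≡⟨ G-σ x p q q<p ⟩
    Σ[ p ] (λ k → σ q k * w x k) ≡⟨ trans (Σ-suc q _) (cong₂ _+_ (cong (_* w x 0) (σ-suc-zero (suc r))) (Σ-last (suc r) _)) ⟩
    0ℚ * w x 0 + (Σ[ suc r ] (λ k → σ q (suc k) * w x (suc k)) + σ q q * w x q)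
      ≈⟨ +-cong (≈-refl {0ℚ * w x 0}) (+-cong (Σ-cong-≈ (suc r) (λ k k<r → ≈-trans
           (*-congʳ (Integral-w (s≤s (s≤s k<r)) ix) (σ-pred≈sgn k (ℕₚ.<⇒≤ (s≤s k<r))))
           (≈-reflexive (solve 2 (λ s w → s :* w := :- con 1ℚ :* ((:- con 1ℚ :* s) :* w))
                 refl (sgn k) (w x (suc k))))))
         (≈-refl {σ q q * w x q})) ⟩
    0ℚ * w x 0 + (Σ[ suc r ] (λ k → - 1ℚ * (sgn (suc k) * w x (suc k))) + σ q q * w x q)
      ≡⟨ cong (λ z → 0ℚ * w x 0 + (z + σ q q * w x q)) (Σ-*ˡ (suc r) (- 1ℚ) _) ⟩
    0ℚ * w x 0 + (- 1ℚ * S + σ q q * w x q)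
      -- `w x 0` equals 1 and is missing from the sum because `σ q 0` is 0. Completing the sum by it
      -- creates the constant that becomes the -1 of the theorem.
      ≡⟨ solve 3 (λ x s t →
           let w₀ = ((x :+ con 1ℚ) :* con 1ℚ :- x :* con 1ℚ) :* con 1ℚ in
           con 0ℚ :* w₀ :+ (:- con 1ℚ :* s :+ t) := con 1ℚ :- (con 1ℚ :* w₀ :+ s) :+ t) refl x S (σ q q * w x q) ⟩
    1ℚ - (1ℚ * w x 0 + S) + σ q q * w x q
      ≡⟨ cong (λ z → 1ℚ - z + σ q q * w x q) (trans (sym (Σ-suc (suc r) _)) (Σ-sgn-w x)) ⟩
    1ℚ - (Φ (x + 1ℚ) - Φ x) + σ q q * w x q ∎
    where
    open SetoidReasoning ≈-setoid
    S = Σ[ suc r ] (λ k → sgn (suc k) * w x (suc k))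

  -- With W = γW p this is σ w + w + W = W (σ ((x + 1)^p - x^p) + 1), since (p-1)! σ = 1 gives σ + 1 = p σ W.
  σ*w≈ : ∀ {x} → Integral x → σ q q * w x q ≈ - w x q - γW p
  σ*w≈ {x} ix = begin
    s * (D * i) ≡⟨ solve 4 (λ s d i f → s :* (d :* i) := (con 1ℚ :+ f) :* s :* d :* i :- (f :* s) :* (d :* i))
          refl s D i F ⟩
    (1ℚ + F) * s * D * i - F * s * (D * i) ≡⟨ cong (λ z → (1ℚ + F) * s * D * i - z * (D * i)) (σ-diagonal q) ⟩
    (1ℚ + F) * s * D * i - 1ℚ * (D * i)
      ≡⟨ solve 4 (λ f s d i → (con 1ℚ :+ f) :* s :* d :* i :- con 1ℚ :* (d :* i) := ((f :+ con 1ℚ) :* i) :* (s :* d) :- d :* i)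
            refl F s D i ⟩
    W * (s * D) - D * i
      ≈⟨ minus-cong (*-congˡ IW (≈-trans (*-congʳ ID σ-pred-pred≈-1) (*-congˡ (Integral-ι -[1+ 0 ]) D≈1))) (≈-refl {D * i}) ⟩
    W * (- 1ℚ * 1ℚ) - D * i ≡⟨ solve 2 (λ w t → w :* (:- con 1ℚ :* con 1ℚ) :- t := :- t :- w) refl W (D * i) ⟩
    - (D * i) - W ≡⟨ cong (λ z → - (D * i) - z * i) (ν-+ (q !) 1) ⟨
    - w x q - γW p ∎
    where
    open SetoidReasoning ≈-setoid
    s = σ q q
    i = inv p
    F = ℕ→ℚ (q !)
    D = ((x + 1ℚ) ^ℚ p) - (x ^ℚ p)
    W = (F + 1ℚ) * i
    ID : Integral D
    ID = Integral-minus (Integral-^ p (Integral-+ ix (Integral-ν 1))) (Integral-^ p ix)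
    D≈1 : D ≈ 1ℚ
    D≈1 = ≈-trans (minus-cong (fermat (Integral-+ ix (Integral-ν 1))) (fermat ix))
      (≈-reflexive (solve 1 (λ x → (x :+ con 1ℚ) :- x := con 1ℚ) refl x))
    IW : Integral W
    -- The quotient stored in Wilson's congruence is `W` itself.
    IW = subst Integral (sym (trans (cong (_* i) (_≈_.eq wilson)) (P*inv (_≈_.quotient wilson)))) (_≈_.integrality wilson)

  -- The denominators k+1 and p-1-k add up to p, so their inverses are opposite modulo p; for odd p
  -- the sign (-1)^(p-2-k) = -(-1)^k compensates. This turns the weights of `γM` into coefficients
  -- of log(1+t)/t.
  logCoef-reflect : ∀ k → k ≤ r → logCoef (suc (r ∸ k)) ≈ sgn k * inv (suc k)
  logCoef-reflect k k≤r = begin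
    sgn (suc j) * inv (suc (suc j)) ≡⟨ cong (_* inv (suc (suc j))) sgn-j ⟩
    - sgn k * b ≡⟨ solve 3 (λ s a b → :- s :* b := s :* a :- s :* (a :+ b)) refl (sgn k) a b ⟩
    sgn k * a - sgn k * (a + b) ≡⟨ cong (λ z → sgn k * a - sgn k * z) a+b ⟩
    sgn k * a - sgn k * (P * (a * b)) ≡⟨ cong (λ z → sgn k * a - z) (solve 3 (λ s p c → s :* (p :* c) := p :* (s :* c))
          refl (sgn k) P (a * b)) ⟩
    sgn k * a - P * (sgn k * (a * b))
      ≈⟨ minus-cong (≈-refl {sgn k * a}) (p*≈0 (Integral-* (Integral-sgn k) (Integral-* (Integral-inv-< k+1<p) (Integral-inv-< j+2<p)))) ⟩
    sgn k * a - 0ℚ ≡⟨ solve 1 (λ a → a :- con 0ℚ := a) refl (sgn k * a) ⟩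
    sgn k * a ∎
    where
    open SetoidReasoning ≈-setoid
    j = r ∸ k
    k+j : k ℕ.+ j ≡ r
    k+j = ℕₚ.m+[n∸m]≡n k≤r
    a = inv (suc k)
    b = inv (suc (suc j))
    k+1<p : suc k < p
    k+1<p = s≤s (s≤s (ℕₚ.m≤n⇒m≤1+n k≤r))
    j+2<p : suc (suc j) < p
    j+2<p = s≤s (s≤s (s≤s (ℕₚ.m∸n≤m r k)))
    sgn-r : sgn r ≡ 1ℚ
    sgn-r = trans (solve 1 (λ s → s := :- con 1ℚ :* (:- con 1ℚ :* s)) refl (sgn r)) (cong (- 1ℚ *_) sgn-pred-pred)
    sgn-j : sgn (suc j) ≡ - sgn k
    sgn-j = E.begin
      - 1ℚ * sgn j E.≡⟨ cong (- 1ℚ *_) (trans (cong (_* sgn j) (sgn² k)) (*-identityˡ (sgn j))) ⟨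
      - 1ℚ * (sgn k * sgn k * sgn j) E.≡⟨ solve 2 (λ a b → :- con 1ℚ :* (a :* a :* b) := :- (a :* (a :* b)))
            refl (sgn k) (sgn j) ⟩
      - (sgn k * (sgn k * sgn j)) E.≡⟨ cong (λ z → - (sgn k * z)) (trans (sym (sgn-+ k j)) (trans (cong sgn k+j) sgn-r)) ⟩
      - (sgn k * 1ℚ) E.≡⟨ cong -_ (*-identityʳ (sgn k)) ⟩
      - sgn k E.∎
      where module E = ≡-Reasoning
    a+b : a + b ≡ P * (a * b)
    a+b = E.begin
      a + b E.≡⟨ solve 2 (λ a b → a :+ b := con 1ℚ :* a :+ con 1ℚ :* b) refl a b ⟩
      1ℚ * a + 1ℚ * b E.≡⟨ cong₂ (λ u v → u * a + v * b) (ν*inv (suc j)) (ν*inv k) ⟨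
      ℕ→ℚ (suc (suc j)) * b * a + ℕ→ℚ (suc k) * a * b
        E.≡⟨ solve 4 (λ u v a b → u :* b :* a :+ v :* a :* b := (v :+ u) :* (a :* b))
              refl (ℕ→ℚ (suc (suc j))) (ℕ→ℚ (suc k)) a b ⟩
      (ℕ→ℚ (suc k) + ℕ→ℚ (suc (suc j))) * (a * b) E.≡⟨ cong (_* (a * b)) (ν-+ (suc k) (suc (suc j))) ⟨
      ℕ→ℚ (suc k ℕ.+ suc (suc j)) * (a * b)
        E.≡⟨ cong (λ n → ℕ→ℚ n * (a * b)) (trans (cong suc (trans (ℕₚ.+-suc k (suc j)) (cong suc (ℕₚ.+-suc k j)))) (cong (λ n → suc (suc (suc n))) k+j)) ⟩
      P * (a * b) E.∎
      where module E = ≡-Reasoning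

  -- Evaluation of γM modulo p

  γM≈ : ∀ {x} → Integral x → γM x p ≈ binomQ x q - inv p - G q x
  γM≈ {x} ix = begin
    γM x p ≡⟨ sumQ-upTo (suc r) _ ⟩
    Σ[ suc r ] (λ i → sgn i * G (suc i) x * inv (suc i))
      ≈⟨ Σ-cong-≈ (suc r) (λ k k≤r → ≈-trans
           (≈-reflexive (solve 3 (λ s g i → s :* g :* i := g :* (s :* i))
                 refl (sgn k) (G (suc k) x) (inv (suc k))))
           (*-congˡ (Integral-G (suc k) (s≤s k≤r) ix) (≈-sym (logCoef-reflect k (ℕₚ.≤-pred k≤r))))) ⟩
    Σ[ suc r ] (λ i → G (suc i) x * logCoef (suc (r ∸ i))) ≡⟨ conv-def (g ∘ suc) (logCoef ∘ suc) r ⟨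
    c ≡⟨ solve 3 (λ c l g → c := (con 1ℚ :* (con 1ℚ :* l) :+ c :+ g :* con 1ℚ) :- l :- g) refl c (inv p) (G q x) ⟩
    (1ℚ * (1ℚ * inv p) + c + G q x * 1ℚ) - inv p - G q x ≡⟨ cong (λ z → z - inv p - G q x) convolution ⟨
    binomQ x q - inv p - G q x ∎
    where
    open SetoidReasoning ≈-setoid
    g : ℕ → ℚ
    g m = G m x
    c = conv (g ∘ suc) (logCoef ∘ suc) r
    -- Both end terms of the convolution are set apart: G_0(x) = 1 meets 1/p, and G_{p-1}(x) meets
    -- 1.
    convolution : binomQ x q ≡ 1ℚ * (1ℚ * inv p) + c + G q x * 1ℚ
    convolution = E.begin
      binomQ x q E.≡⟨ conv-Σσw x p q q<p ⟨
      conv (λ m → Σ[ p ] (λ k → σ m k * w x k)) logCoef q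
        E.≡⟨ conv-cong {g = logCoef} q (λ m m≤q → sym (G-σ x p m (s≤s m≤q))) (λ _ → refl) ⟩
      conv g logCoef q E.≡⟨ conv-last g logCoef (suc r) ⟩
      conv g (logCoef ∘ suc) (suc r) + G q x * 1ℚ E.≡⟨ cong (_+ G q x * 1ℚ) (conv-head g (logCoef ∘ suc) r) ⟩
      1ℚ * (sgn q * inv p) + c + G q x * 1ℚ E.≡⟨ cong (λ s → 1ℚ * (s * inv p) + c + G q x * 1ℚ) sgn-pred ⟩
      1ℚ * (1ℚ * inv p) + c + G q x * 1ℚ E.∎
      where module E = ≡-Reasoning

  γM-formula : ∀ {x} → Integral x → γM x p ≈ γW p + ℓ (x + 1ℚ + 1ℚ) p - ℓ (x + 1ℚ) p + binomQ x q - 1ℚ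
  γM-formula {x} ix = begin
    γM x p ≈⟨ γM≈ ix ⟩
    b - i - G q x
      ≈⟨ minus-cong (≈-refl {b - i}) (≈-trans (G-pred ix) (+-cong
           (minus-cong (≈-refl {1ℚ}) (minus-cong (≈-sym (Φ-frobenius (Integral-+ ix (Integral-ν 1)))) (≈-sym (Φ-frobenius ix))))
           (σ*w≈ ix))) ⟩
    b - i - (1ℚ - ((x₂ - x₁ - 1ℚ) * i - (x₁ - x₀ - 1ℚ) * i) + (- ((x₁ - x₀) * i) - W))
      -- The integral of y^(p-1) reduces the second difference x₂ - 2x₁ + x₀ to x₂ - x₁, and the
      -- remaining -1/p is the linear part of the two ℓ-terms, since (x+2) - (x+1) = 1.
      ≡⟨ solve 7 (λ b i x₂ x₁ x₀ W x →
           b :- i :- (con 1ℚ :- ((x₂ :- x₁ :- con 1ℚ) :* i :- (x₁ :- x₀ :- con 1ℚ) :* i) :+ (:- ((x₁ :- x₀) :* i) :- W))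
           := W :+ (x₂ :- (x :+ con 1ℚ :+ con 1ℚ)) :* i :- (x₁ :- (x :+ con 1ℚ)) :* i :+ b :- con 1ℚ) refl
           b i x₂ x₁ x₀ W x ⟩
    γW p + ℓ (x + 1ℚ + 1ℚ) p - ℓ (x + 1ℚ) p + b - 1ℚ ∎
    where
    open SetoidReasoning ≈-setoid
    b = binomQ x q
    i = inv p
    x₂ = (x + 1ℚ + 1ℚ) ^ℚ p
    x₁ = (x + 1ℚ) ^ℚ p
    x₀ = x ^ℚ p
    W = γW p

  -- By `binomQ-pred` and Fermat, (x+1) binom(x, p-1) ≡ x - x^p ≡ 0, and a nonzero numerator of x +
  -- 1 below p is invertible modulo p.
  binomQ-q≈0 : ∀ {x} → Integral x → ↥ (x + 1ℚ) ≢ pos 0 → ℤ.∣ ↥ (x + 1ℚ) ∣ < p → binomQ x q ≈ 0ℚ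
  binomQ-q≈0 {x} ix n≢0 n<p = cancel (↥ (x + 1ℚ)) n≢0 n<p (begin
    ι (↥ (x + 1ℚ)) * b ≡⟨ cong (_* b) (*-↧ (x + 1ℚ)) ⟨
    (x + 1ℚ) * d * b ≡⟨ solve 3 (λ y d b → y :* d :* b := d :* (y :* b)) refl (x + 1ℚ) d b ⟩
    d * ((x + 1ℚ) * b) ≈⟨ *-congˡ (Integral-ν (↧ₙ (x + 1ℚ))) (≈-trans (binomQ-pred ix) (minus-cong (≈-refl {x}) (fermat ix))) ⟩
    d * (x - x) ≡⟨ solve 2 (λ d x → d :* (x :- x) := con 0ℚ) refl d x ⟩
    0ℚ ∎)
    where
    open SetoidReasoning ≈-setoid
    b = binomQ x q
    d = ℕ→ℚ (↧ₙ (x + 1ℚ))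
    cancel : ∀ n {a} → n ≢ pos 0 → ℤ.∣ n ∣ < p → ι n * a ≈ 0ℚ → a ≈ 0ℚ
    cancel (pos zero) n≢0 _ _ = contradiction refl n≢0
    cancel (pos (suc n)) _ n<p h = ν*-cancel-≈ (∤-< n<p) (≈-trans h (≈-reflexive (sym (*-zeroʳ (ℕ→ℚ (suc n))))))
    cancel -[1+ n ] {a} _ n<p h = ν*-cancel-≈ (∤-< n<p) (begin
      ℕ→ℚ (suc n) * a ≡⟨ solve 2 (λ v a → v :* a := :- ((:- v) :* a)) refl (ℕ→ℚ (suc n)) a ⟩
      - (- ℕ→ℚ (suc n) * a) ≈⟨ neg-cong h ⟩
      0ℚ ≡⟨ *-zeroʳ (ℕ→ℚ (suc n)) ⟨
      ℕ→ℚ (suc n) * 0ℚ ∎)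

  ≈δ₋₁ : ∀ {a} x → (x ≡ - 1ℚ → a ≈ 1ℚ) → (x ≢ - 1ℚ → a ≈ 0ℚ) → a ≈ δ₋₁ x
  ≈δ₋₁ x h₁ h₀ with x ≟ - 1ℚ
  ... | yes x≡-1 = h₁ x≡-1
  ... | no  x≢-1 = h₀ x≢-1

  binomQ-q≈δ₋₁ : ∀ {x} → Integral x → ℤ.∣ ↥ (x + 1ℚ) ∣ < p → binomQ x q ≈ δ₋₁ x
  binomQ-q≈δ₋₁ {x} ix n<p = ≈δ₋₁ x
    (λ x≡-1 → ≈-reflexive (trans (cong (λ y → binomQ y q) x≡-1) (trans (binomQ-neg1 q) sgn-pred)))
    (λ x≢-1 → binomQ-q≈0 ix (λ e → x≢-1 (trans (solve 1 (λ x → x := (x :+ con 1ℚ) :- con 1ℚ) refl x)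
      (cong (_- 1ℚ) (↥p≡0⇒p≡0 (x + 1ℚ) e)))) n<p)

-- The explicit bound on p and the theorem

γM-bound : ∀ x p → Prime p → 2 ℕ.+ (↧ₙ x ℕ.+ ℤ.∣ ↥ (x + 1ℚ) ∣) < p →
  p ∣ ℤ.∣ ↥ (γM x p - (γW p + ℓ (x + 1ℚ + 1ℚ) p - ℓ (x + 1ℚ) p + δ₋₁ x - 1ℚ)) ∣
-- The summand 2 forces p into the form 3 + r, `↧ₙ x` keeps p out of the denominator of x, and the
-- numerator keeps x + 1 invertible modulo p unless x = -1.
γM-bound x (suc (suc (suc r))) pr (s≤s (s≤s (s≤s N≤r))) = ≈⇒∣↥ (≈-trans (γM-formula ix)
  (minus-cong (+-cong (≈-refl {γW p + ℓ (x + 1ℚ + 1ℚ) p - ℓ (x + 1ℚ) p}) (binomQ-q≈δ₋₁ ix (small (ℕₚ.m≤n+m _ (↧ₙ x))))) (≈-refl {1ℚ})))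
  where
  open OddPrime r pr
  small : ∀ {n} → n ≤ ↧ₙ x ℕ.+ ℤ.∣ ↥ (x + 1ℚ) ∣ → n < p
  small n≤N = s≤s (ℕₚ.≤-trans n≤N (ℕₚ.≤-trans N≤r (ℕₚ.m≤n+m r 2)))
  ix : Integral x
  ix = integral (↧ₙ x) (↥ x) (∤-< (small (ℕₚ.m≤m+n (↧ₙ x) _))) (*-↧ x)

-- Both ℓ-terms vanish, being taken at 1 and at 0, and the indicator cancels the -1. The index is a
-- successor because 0^0 is 1.
γM-neg1 : ∀ p → γW (suc p) + ℓ (- 1ℚ + 1ℚ + 1ℚ) (suc p) - ℓ (- 1ℚ + 1ℚ) (suc p) + δ₋₁ (- 1ℚ) - 1ℚ ≡ γW (suc p)
γM-neg1 p = trans (cong₂ (λ a b → γW (suc p) + (a - 1ℚ) * inv (suc p) - (b - 0ℚ) * inv (suc p) + 1ℚ - 1ℚ) (1^ (suc p)) (0^suc p))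
  (solve 2 (λ W i → W :+ (con 1ℚ :- con 1ℚ) :* i :- (con 0ℚ :- con 0ℚ) :* i :+ con 1ℚ :- con 1ℚ := W)
        refl (γW (suc p)) (inv (suc p)))

theorem3p4 : (∀ (x : ℚ) →
    γM x ≡𝒜 (λ p → γW p + ℓ (x + 1ℚ + 1ℚ) p - ℓ (x + 1ℚ) p + δ₋₁ x - 1ℚ))
    × (γM (- 1ℚ) ≡𝒜 γW)
theorem3p4 = general , 4 , special
  where
  general : ∀ x → γM x ≡𝒜 (λ p → γW p + ℓ (x + 1ℚ + 1ℚ) p - ℓ (x + 1ℚ) p + δ₋₁ x - 1ℚ)
  general x = 2 ℕ.+ (↧ₙ x ℕ.+ ℤ.∣ ↥ (x + 1ℚ) ∣) , γM-bound x
  -- At x = -1 the general bound is 2 + (1 + 0) = 3, which 4 exceeds.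
  special : ∀ p → Prime p → 4 < p → p ∣ ℤ.∣ ↥ (γM (- 1ℚ) p - γW p) ∣
  special (suc p) pr 4<p = subst (λ z → suc p ∣ ℤ.∣ ↥ (γM (- 1ℚ) (suc p) - z) ∣) (γM-neg1 p)
    (γM-bound (- 1ℚ) (suc p) pr (ℕₚ.<-trans (ℕₚ.n<1+n 3) 4<p))
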